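{- Let $\{A_0=I_n,A_1,A_2\}$ be the set of adjacency matrices of a non-symmetric association scheme with $2$ classes and order $n\ge5$. Let $\mathbf 1$ denote the all-one row vector of length $n$ and let $$C_1=\begin{bmatrix}0&\mathbf 1&0&0\\ 0&A_1&A_2&\mathbf 1^T\\ \mathbf 1^T&A_2&A_1&0\\ 0&0&\mathbf 1&0\end{bmatrix},$$ a square matrix of order $2(n+1)$. Let $$B=\begin{bmatrix}0&C_1\\ C_1^T&0\end{bmatrix}$$ be the adjacency matrix of an undirected graph $\Gamma$. Then $\Gamma$ is a connected bipartite amply regular graph with diameter $d=4$ and parameters $(v,k,\lambda,\mu)=\left(4(n+1),\,n,\,0,\,\frac{n-1}{2}\right)$, and $\Gamma$ is a $Q$-regular graph with distribution diagram $\mathcal Q_k$ (defined in the context) with $k=n$.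
   Context: All graphs are finite, simple and undirected unless stated otherwise. An association scheme with $m$ classes and order $n$ is given by non-zero $0/1$ matrices $A_0,\dots,A_m$ of order $n$ (its adjacency matrices) with $A_0=I$, $\sum_i A_i=J$ (all-ones matrix), $A_i^T\in\{A_0,\dots,A_m\}$ for all $i$, and each $A_iA_j$ a linear combination of $A_0,\dots,A_m$. It is non-symmetric if not all $A_i$ are symmetric. An amply regular graph with parameters $(v,k,\lambda,\mu)$ is a $k$-regular graph on $v$ vertices such that every pair of adjacent vertices has exactly $\lambda$ common neighbors and every pair of vertices at distance two has exactly $\mu$ common neighbors. A partition $\{B_1,\dots,B_r\}$ of $V(\Gamma)$ is equitable with quotient matrix $Q=(q_{ij})$ if every vertex of $B_i$ has exactly $q_{ij}$ neighbors in $B_j$, for all $i,j$. The distribution diagram of the partition records the sizes $|B_i|$ and the numbers $q_{ij}$ (it is used interchangeably with the quotient matrix). $\Gamma$ is $Q$-regular if for each vertex $x$ there is an equitable partition of $V(\Gamma)$ with quotient matrix $Q$ such that $\{x\}$ is a part. The distribution diagram $\mathcal Q_k$ has six cells $P_0,P_1,P_2,P_3,P_4,P_5$ of sizes $1,\ k,\ 2k,\ k,\ 1,\ 2$ respectively, with $P_0=\{x\}$, and with the following quotient numbers (all unlisted ones are $0$): $q_{01}=k$; $q_{10}=1$, $q_{12}=k-1$; $q_{21}=\frac{k-1}{2}$, $q_{23}=\frac{k-1}{2}$, $q_{25}=1$; $q_{32}=k-1$, $q_{34}=1$; $q_{43}=k$; $q_{52}=k$. -}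

module Defs where

open import Algebra.Bundles using (CommutativeRing)
import Algebra.Properties.Semiring.Sum as SemiringSum
open import Data.Bool.Base using (Bool; if_then_else_)
open import Data.Fin.Base using (Fin; zero; suc; splitAt)
import Data.Fin.Properties as Fin
open import Data.Fin.Subset using (Subset; _∈_; _∩_; ⁅_⁆; ∣_∣)
open import Data.Integer.Base using (+_)
open import Data.Nat.Base using (ℕ; zero; suc; _+_; _*_; _∸_; _≤_; _<_; _/_)
import Data.Nat.Properties as ℕ
open import Data.Product.Base using (Σ; ∃; ∃₂; _×_; _,_)
open import Data.Rational.Base as ℚ using (ℚ)
import Data.Rational.Properties as ℚ
open import Data.Sum.Base using (_⊎_; inj₁; inj₂)
open import Data.Vec.Base using (tabulate; lookup; _∷_; [])
open import Data.Vec.Functional using (Vector; _++_; zipWith)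
open import Relation.Binary.Definitions using (Decidable; Irreflexive; Symmetric)
open import Relation.Binary.PropositionalEquality using (_≡_; _≢_; refl; sym; trans)
open import Relation.Nullary.Decidable using (does)
open import Relation.Nullary.Negation using (¬_)

open SemiringSum ℕ.+-*-semiring using () renaming (sum to sumℕ)
open SemiringSum (CommutativeRing.semiring ℚ.+-*-commutativeRing) using () renaming (sum to sumℚ)

Matrix : ℕ → ℕ → Set
Matrix r c = Vector (Vector ℕ c) r

infix 4 _≐_
_≐_ : ∀ {r c} → Matrix r c → Matrix r c → Set
M ≐ N = ∀ i j → M i j ≡ N i j

infix 10 _ᵀ
_ᵀ : ∀ {r c} → Matrix r c → Matrix c r
(M ᵀ) i j = M j i

infixl 7 _·_
_·_ : ∀ {r s c} → Matrix r s → Matrix s c → Matrix r c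
(M · N) i j = sumℕ (λ k → M i k * N k j)

O : ∀ {r c} → Matrix r c
O _ _ = 0

𝟙 : ∀ {r c} → Matrix r c
𝟙 _ _ = 1

I : ∀ {n} → Matrix n n
I i j = if does (i Fin.≟ j) then 1 else 0

infixr 6 _∥_
_∥_ : ∀ {r c d} → Matrix r c → Matrix r d → Matrix r (c + d)
_∥_ = zipWith _++_

infixr 5 _⫽_
_⫽_ : ∀ {r s c} → Matrix r c → Matrix s c → Matrix (r + s) c
_⫽_ = _++_

Is01 : ∀ {r c} → Matrix r c → Set
Is01 M = ∀ i j → M i j ≡ 0 ⊎ M i j ≡ 1

ι : ℕ → ℚ
ι a = + a ℚ./ 1

-- Rational coefficients lose nothing with respect to real or complex ones: the
-- Aₖ are non-zero 0/1 matrices with disjoint supports, so the coefficients of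
-- a linear combination with integer entries are themselves integers.
LinearCombination : ∀ {m r c} → Vector (Matrix r c) m → Matrix r c → Set
LinearCombination {m} A M = ∃ λ (p : Vector ℚ m) →
  ∀ i j → ι (M i j) ≡ sumℚ (λ k → p k ℚ.* ι (A k i j))

record AssociationScheme (m n : ℕ) : Set where
  field
    A         : Vector (Matrix n n) (suc m)
    zero-one  : ∀ i → Is01 (A i)
    non-zero  : ∀ i → ¬ (A i ≐ O)
    A₀≐I      : A zero ≐ I
    sum≐J     : (λ x y → sumℕ (λ i → A i x y)) ≐ 𝟙
    transpose : ∀ i → ∃ λ j → (A i) ᵀ ≐ A j
    product   : ∀ i j → LinearCombination A (A i · A j)

NonSymmetric : ∀ {m n} → AssociationScheme m n → Set
NonSymmetric S = ¬ (∀ i → A i ᵀ ≐ A i)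
  where open AssociationScheme S

record Graph : Set₁ where
  infix 4 _~_ _~?_
  field
    order  : ℕ
    _~_    : Fin order → Fin order → Set
    _~?_   : Decidable _~_
    ~-sym  : Symmetric _~_
    ~-irr  : Irreflexive _≡_ _~_

  Vertex : Set
  Vertex = Fin order

  neighbours : Vertex → Subset order
  neighbours x = tabulate (λ y → does (x ~? y))

  data Walk : ℕ → Vertex → Vertex → Set where
    nil  : ∀ {x} → Walk 0 x x
    cons : ∀ {ℓ x y z} → x ~ y → Walk ℓ y z → Walk (suc ℓ) x z

  Distance : Vertex → Vertex → ℕ → Set
  Distance x y d = Walk d x y × (∀ {ℓ} → ℓ < d → ¬ Walk ℓ x y)

Connected : Graph → Set
Connected Γ = ∀ x y → ∃ λ ℓ → Walk ℓ x y
  where open Graph Γ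

Bipartite : Graph → Set
Bipartite Γ = Σ (Vertex → Bool) λ colour → ∀ {x y} → x ~ y → colour x ≢ colour y
  where open Graph Γ

Diameter : Graph → ℕ → Set
Diameter Γ d = (∀ x y → ∃ λ e → e ≤ d × Distance x y e) × (∃₂ λ x y → Distance x y d)
  where open Graph Γ

record AmplyRegular (Γ : Graph) (v k lam mu : ℕ) : Set where
  open Graph Γ
  field
    order≡v  : order ≡ v
    regular  : ∀ x → ∣ neighbours x ∣ ≡ k
    adjacent : ∀ x y → x ~ y → ∣ neighbours x ∩ neighbours y ∣ ≡ lam
    distance : ∀ x y → Distance x y 2 → ∣ neighbours x ∩ neighbours y ∣ ≡ mu

record IsAdjacencyMatrix {v} (M : Matrix v v) : Set where
  field
    zero-one  : Is01 M
    symmetric : M ᵀ ≐ M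
    loopless  : ∀ x → M x x ≡ 0

fromAdjacencyMatrix : ∀ {v} (M : Matrix v v) → IsAdjacencyMatrix M → Graph
fromAdjacencyMatrix {v} M isAdj = record
  { order = v
  ; _~_   = λ x y → M x y ≡ 1
  ; _~?_  = λ x y → M x y ℕ.≟ 1
  ; ~-sym = λ {x} {y} x~y → trans (symmetric x y) x~y
  ; ~-irr = λ { {x} refl x~x → ℕ.0≢1+n (trans (sym (loopless x)) x~x) }
  }
  where open IsAdjacencyMatrix isAdj

record Partition (v r : ℕ) : Set where
  field
    part     : Fin v → Fin r
    nonempty : ∀ i → ∃ λ x → part x ≡ i

  cell : Fin r → Subset v
  cell i = tabulate (λ x → does (part x Fin.≟ i))

Equitable : ∀ {r} (Γ : Graph) → Partition (Graph.order Γ) r → Matrix r r → Set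
Equitable Γ π q = ∀ i j x → x ∈ cell i → ∣ neighbours x ∩ cell j ∣ ≡ q i j
  where open Graph Γ; open Partition π

-- `root` is the cell that is required to be {x}.
record DistributionDiagram : Set where
  field
    cells    : ℕ
    root     : Fin cells
    size     : Vector ℕ cells
    quotient : Matrix cells cells

QRegular : Graph → DistributionDiagram → Set
QRegular Γ D = ∀ x → Σ (Partition order cells) λ π →
  Equitable Γ π quotient ×
  (∀ i → ∣ Partition.cell π i ∣ ≡ size i) ×
  Partition.cell π root ≡ ⁅ x ⁆
  where open Graph Γ; open DistributionDiagram D

-- `_/_` is the integer quotient, so this is the intended diagram for odd k only.
𝒬 : ℕ → DistributionDiagram
𝒬 k = record
  { cells    = 6
  ; root     = zero
  ; size     = lookup (1 ∷ k ∷ 2 * k ∷ k ∷ 1 ∷ 2 ∷ [])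
  ; quotient = λ i → lookup (lookup
      ( (0 ∷ k           ∷ 0     ∷ 0           ∷ 0 ∷ 0 ∷ [])
      ∷ (1 ∷ 0           ∷ k ∸ 1 ∷ 0           ∷ 0 ∷ 0 ∷ [])
      ∷ (0 ∷ (k ∸ 1) / 2 ∷ 0     ∷ (k ∸ 1) / 2 ∷ 0 ∷ 1 ∷ [])
      ∷ (0 ∷ 0           ∷ k ∸ 1 ∷ 0           ∷ 1 ∷ 0 ∷ [])
      ∷ (0 ∷ 0           ∷ 0     ∷ k           ∷ 0 ∷ 0 ∷ [])
      ∷ (0 ∷ 0           ∷ k     ∷ 0           ∷ 0 ∷ 0 ∷ [])
      ∷ []) i)
  }

C₁ : ∀ {n} → Matrix n n → Matrix n n → Matrix (1 + (n + (n + 1))) (1 + (n + (n + 1)))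
C₁ {n} A₁ A₂ = (o  ∥ 𝟏  ∥ 𝟎  ∥ o )
             ⫽ (𝟎ᵀ ∥ A₁ ∥ A₂ ∥ 𝟏ᵀ)
             ⫽ (𝟏ᵀ ∥ A₂ ∥ A₁ ∥ 𝟎ᵀ)
             ⫽ (o  ∥ 𝟎  ∥ 𝟏  ∥ o )
  where
  o : Matrix 1 1
  o = O
  𝟎 𝟏 : Matrix 1 n
  𝟎 = O
  𝟏 = 𝟙
  𝟎ᵀ 𝟏ᵀ : Matrix n 1
  𝟎ᵀ = O
  𝟏ᵀ = 𝟙

B : ∀ {r} → Matrix r r → Matrix (r + r) (r + r)
B C = (O   ∥ C)
    ⫽ (C ᵀ ∥ O)

private
  O-01 : ∀ {r c} → Is01 (O {r} {c})
  O-01 _ _ = inj₁ refl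

  𝟙-01 : ∀ {r c} → Is01 (𝟙 {r} {c})
  𝟙-01 _ _ = inj₂ refl

  ∥-01 : ∀ {r c d} (M : Matrix r c) (N : Matrix r d) → Is01 M → Is01 N → Is01 (M ∥ N)
  ∥-01 {c = c} M N p q i j with splitAt c j
  ... | inj₁ k = p i k
  ... | inj₂ k = q i k

  ⫽-01 : ∀ {r s c} (M : Matrix r c) (N : Matrix s c) → Is01 M → Is01 N → Is01 (M ⫽ N)
  ⫽-01 {r = r} M N p q i with splitAt r i
  ... | inj₁ k = p k
  ... | inj₂ k = q k

  row-01 : ∀ {r a b c d} {M : Matrix r a} {N : Matrix r b} {P : Matrix r c} {Q : Matrix r d} →
           Is01 M → Is01 N → Is01 P → Is01 Q → Is01 (M ∥ N ∥ P ∥ Q)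
  row-01 {M = M} {N} {P} {Q} m n p q =
    ∥-01 M (N ∥ P ∥ Q) m (∥-01 N (P ∥ Q) n (∥-01 P Q p q))

C₁-01 : ∀ {n} {A₁ A₂ : Matrix n n} → Is01 A₁ → Is01 A₂ → Is01 (C₁ A₁ A₂)
C₁-01 {n} p q =
  ⫽-01 _ _ (row-01 {1} {1} {n} {n} {1} O-01 𝟙-01 O-01 O-01)
    (⫽-01 _ _ (row-01 {n} {1} {n} {n} {1} O-01 p q 𝟙-01)
      (⫽-01 _ _ (row-01 {n} {1} {n} {n} {1} 𝟙-01 q p O-01)
        (row-01 {1} {1} {n} {n} {1} O-01 O-01 𝟙-01 O-01)))

B-isAdjacencyMatrix : ∀ {r} {C : Matrix r r} → Is01 C → IsAdjacencyMatrix (B C)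
B-isAdjacencyMatrix {r} {C} p = record
  { zero-one  = ⫽-01 (O ∥ C) (C ᵀ ∥ O) (∥-01 O C O-01 p) (∥-01 (C ᵀ) O (λ i j → p j i) O-01)
  ; symmetric = symm
  ; loopless  = loop
  }
  where
  symm : B C ᵀ ≐ B C
  symm x y with splitAt r x in eqx | splitAt r y in eqy
  ... | inj₁ _ | inj₁ _ rewrite eqx | eqy = refl
  ... | inj₁ _ | inj₂ _ rewrite eqx | eqy = refl
  ... | inj₂ _ | inj₁ _ rewrite eqx | eqy = refl
  ... | inj₂ _ | inj₂ _ rewrite eqx | eqy = refl

  loop : ∀ x → B C x x ≡ 0
  loop x with splitAt r x in eq
  ... | inj₁ _ rewrite eq = refl
  ... | inj₂ _ rewrite eq = refl

schemeGraph : ∀ {n} → AssociationScheme 2 n → Graph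
schemeGraph S = fromAdjacencyMatrix (B (C₁ (A one) (A two)))
  (B-isAdjacencyMatrix (C₁-01 (zero-one one) (zero-one two)))
  where
  open AssociationScheme S
  one two : Fin 3
  one = suc zero
  two = suc (suc zero)

{-# OPTIONS --safe #-}
module Submission where

-- Non-symmetry forces A₂ = A₁ᵀ, so A₁ is a tournament, and the product axiom
-- makes it doubly regular: out- and in-degree k = (n − 1)/2, and any two
-- vertices have l common out-neighbours and l common in-neighbours, k = 1 + 2l.
-- Adding a source to this tournament gives a tournament W on n + 1 vertices, and C₁ is
-- [[W, Wᵀ], [Wᵀ, W]] up to reordering: rows and columns are pairs (p, sign).
-- Let σ flip the sign.  Then C₁ᵀ x y = C₁ (σ x) y, the rows x and σ x are
-- disjoint and together miss only the columns x and σ x, and any other two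
-- distinct rows meet in k columns.  From a row x the cells P₀, …, P₅ are then
-- {x}, the columns in row x, the rows other than x and σ x, the columns in row
-- σ x, {σ x}, and the columns x and σ x.  The same holds for C₁ᵀ, which
-- settles the base points among the columns.
open import Defs
import Algebra.Properties.Semiring.Sum as SemiringSum
open import Data.Bool.Base using (Bool; true; false; if_then_else_; not)
open import Data.Bool.Properties using (not-involutive; not-¬)
open import Data.Fin.Base using (Fin; zero; suc; splitAt; _↑ˡ_; _↑ʳ_)
open import Data.Fin.Patterns using (0F; 1F; 2F; 3F; 4F; 5F)
import Data.Fin.Properties as Fin
open import Data.Fin.Subset using (_∈_; _∩_; ⁅_⁆; ∣_∣)
open import Data.Fin.Subset.Properties using (⊆-antisym; x∈⁅x⁆; x∈⁅y⁆⇒x≡y)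
open import Data.Integer.Base using () renaming (+_ to pos)
import Data.Integer.Properties as ℤ
open import Data.Nat.Base using (ℕ; zero; suc; NonZero; >-nonZero; _+_; _*_; _∸_; _/_; _≤_; _<_; z≤n; s≤s; z<s; s<s)
open import Data.Nat.Divisibility using (_∣_; divides)
open import Data.Nat.DivMod using (m*n/n≡m)
import Data.Nat.Properties as ℕ
open import Data.Nat.Tactic.RingSolver using (solve-∀)
open import Data.Product.Base using (∃; ∃₂; _×_; _,_; proj₁; proj₂)
open import Data.Rational.Base as ℚ using (0ℚ)
import Data.Rational.Properties as ℚ
open import Data.Rational.Unnormalised.Base using (mkℚᵘ; *≡*)
open import Data.Sum.Base using (_⊎_; inj₁; inj₂; [_,_]′)
open import Data.Vec.Base using (tabulate)
open import Data.Vec.Functional using (Vector)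
open import Data.Vec.Properties using (lookup∘tabulate; []=⇒lookup; lookup⇒[]=)
open import Function.Base using (_∘_; const)
open import Relation.Binary.PropositionalEquality
open import Relation.Nullary.Decidable using (does; yes; no; dec-true; dec-false)
open import Relation.Nullary.Negation using (¬_; contradiction)

open SemiringSum ℕ.+-*-semiring using (sum; sum-cong-≗; ∑-distrib-+; ∑-comm; *-distribˡ-sum)
open ≡-Reasoning

-- Put `S p q = W p q - W q p`. Then `S` is a skew conference matrix of order `n + 1`, and the entry
-- of `C₁` at `(p , s)` and `(q , t)` is 1 exactly when `S p q`, multiplied by the signs `s` and
-- `t`, is +1. Skewness of `S` is why flipping a sign transposes `C₁`; orthogonality of distinct
-- rows of `S` is why generic rows meet in `k` columns. The source is there to make the rows
-- orthogonal. The product axiom acts through one remark: an entry of `A i · A j` depends only on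
-- the relation between its row and its column. Since `A₁ A₁ᵀ` is symmetric, both orientations of an
-- arc give the same count, so a single number `l` serves all pairs. All counting stays in ℕ, so
-- identities that would involve a difference are stated with the subtracted term moved to the other
-- side.

-- Finite sums and the identity matrix

sum-zero : ∀ {n} {f : Vector ℕ n} → (∀ i → f i ≡ 0) → sum f ≡ 0
sum-zero {zero}  f≡0 = refl
sum-zero {suc n} f≡0 = cong₂ _+_ (f≡0 zero) (sum-zero (f≡0 ∘ suc))

sum-const : ∀ n c → sum {n} (λ _ → c) ≡ n * c
sum-const zero    c = refl
sum-const (suc n) c = cong (c +_) (sum-const n c)

sum-↑ : ∀ m {n} (f : Vector ℕ (m + n)) → sum f ≡ sum (λ i → f (i ↑ˡ n)) + sum (λ i → f (m ↑ʳ i))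
sum-↑ zero    f = refl
sum-↑ (suc m) f = trans (cong (f zero +_) (sum-↑ m (f ∘ suc))) (sym (ℕ.+-assoc (f zero) _ _))

-- Turns a positive count into a witness; neighbours and common neighbours are produced this way.
sum-positive : ∀ {n} (f : Vector ℕ n) → 0 < sum f → ∃ λ i → 0 < f i
sum-positive {suc n} f 0<∑ with f zero in eq
... | suc _ = zero , subst (0 <_) (sym eq) z<s
... | zero with sum-positive (f ∘ suc) 0<∑
...   | i , 0<fi = suc i , 0<fi

I-diagonal : ∀ {n} (i : Fin n) → I i i ≡ 1
I-diagonal i = cong (if_then 1 else 0) (dec-true (i Fin.≟ i) refl)

I-≢ : ∀ {n} {i j : Fin n} → i ≢ j → I i j ≡ 0
I-≢ {i = i} {j} i≢j = cong (if_then 1 else 0) (dec-false (i Fin.≟ j) i≢j)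

I-sym : ∀ {n} (i j : Fin n) → I i j ≡ I j i
I-sym i j with i Fin.≟ j
... | yes refl = sym (I-diagonal i)
... | no  i≢j  = sym (I-≢ (i≢j ∘ sym))

sum-*I : ∀ {n} (f : Vector ℕ n) i → sum (λ j → f j * I i j) ≡ f i
sum-*I {suc n} f zero    = begin
  f zero * 1 + sum (λ j → f (suc j) * 0)  ≡⟨ cong₂ _+_ (ℕ.*-identityʳ _) (sum-zero (λ j → ℕ.*-zeroʳ (f (suc j)))) ⟩
  f zero + 0                              ≡⟨ ℕ.+-identityʳ _ ⟩
  f zero                                  ∎
sum-*I {suc n} f (suc i) = cong₂ _+_ (ℕ.*-zeroʳ (f zero)) (sum-*I (f ∘ suc) i)

sum-I : ∀ {n} (i : Fin n) → sum (I i) ≡ 1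
sum-I i = trans (sum-cong-≗ (λ j → sym (ℕ.+-identityʳ (I i j)))) (sum-*I (λ _ → 1) i)

idempotent : ∀ {a} → a ≡ 0 ⊎ a ≡ 1 → a * a ≡ a
idempotent (inj₁ refl) = refl
idempotent (inj₂ refl) = refl

-- Doubly regular tournaments

-- Over ℕ the single identity `N + Nᵀ + I = J` already forces a zero diagonal and 0/1 entries.
record Tournament {n} (N : Matrix n n) : Set where
  field
    arc : ∀ i j → N i j + N j i + I i j ≡ 1

-- For a 0/1 matrix this is the number of columns shared by two rows: common out-neighbours in a
-- tournament, common in-neighbours in its transpose.
gram : ∀ {r c} → Matrix r c → Matrix r r
gram M = M · M ᵀ

gram-sym : ∀ {r c} (M : Matrix r c) i j → gram M i j ≡ gram M j i
gram-sym M i j = sum-cong-≗ (λ l → ℕ.*-comm (M i l) (M j l))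

gram-diagonal : ∀ {r c} {M : Matrix r c} → Is01 M → ∀ i → gram M i i ≡ sum (M i)
gram-diagonal M01 i = sum-cong-≗ (λ l → idempotent (M01 i l))

module _ {n} {N : Matrix n n} (T : Tournament N) where
  open Tournament T

  tournament-diagonal : ∀ i → N i i ≡ 0
  tournament-diagonal i = ℕ.m+n≡0⇒m≡0 (N i i) (ℕ.+-cancelʳ-≡ 1 _ 0
    (trans (cong (N i i + N i i +_) (sym (I-diagonal i))) (arc i i)))

  tournament-≢ : ∀ {i j} → i ≢ j → N i j + N j i ≡ 1
  tournament-≢ {i} {j} i≢j =
    trans (sym (ℕ.+-identityʳ _)) (trans (cong (N i j + N j i +_) (sym (I-≢ i≢j))) (arc i j))

  tournament-orient : ∀ {i j} → i ≢ j → N i j ≡ 1 ⊎ N j i ≡ 1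
  tournament-orient {i} {j} i≢j with N i j | N j i | tournament-≢ i≢j
  ... | zero        | b | eq = inj₂ eq
  ... | suc zero    | b | eq = inj₁ refl
  ... | suc (suc a) | b | ()

  tournament-01 : Is01 N
  tournament-01 i j with i Fin.≟ j
  ... | yes refl = inj₁ (tournament-diagonal i)
  ... | no i≢j with tournament-orient i≢j
  ...   | inj₁ Nij = inj₂ Nij
  ...   | inj₂ Nji = inj₁ (ℕ.+-cancelʳ-≡ 1 _ 0 (trans (cong (N i j +_) (sym Nji)) (tournament-≢ i≢j)))

  tournament-total : ∀ i → sum (N i) + sum ((N ᵀ) i) + 1 ≡ n
  tournament-total i = begin
    sum (N i) + sum ((N ᵀ) i) + 1              ≡⟨ cong₂ _+_ (∑-distrib-+ (N i) ((N ᵀ) i)) (sum-I i) ⟨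
    sum (λ j → N i j + N j i) + sum (I i)      ≡⟨ ∑-distrib-+ (λ j → N i j + N j i) (I i) ⟨
    sum (λ j → N i j + N j i + I i j)          ≡⟨ sum-cong-≗ (arc i) ⟩
    sum {n} (λ j → 1)                          ≡⟨ trans (sum-const n 1) (ℕ.*-identityʳ n) ⟩
    n                                          ∎

record OutDesign {n} (N : Matrix n n) (k l : ℕ) : Set where
  field
    degree : ∀ i → sum (N i) ≡ k
    common : ∀ {i j} → i ≢ j → gram N i j ≡ l

record DoublyRegular {n} (N : Matrix n n) (k l : ℕ) : Set where
  field
    tournament : Tournament N
    out-design : OutDesign N k l
    in-design  : OutDesign (N ᵀ) k l
    k≡1+2l     : k ≡ 1 + (l + l)
    n≡1+2k     : n ≡ 1 + (k + k)

-- The arcs are counted once by tails and once by heads.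
degree-unique : ∀ {n} .{{_ : NonZero n}} {N : Matrix n n} {k k′ l l′} →
                OutDesign N k l → OutDesign (N ᵀ) k′ l′ → k ≡ k′
degree-unique {n} {N} {k} {k′} D D′ = ℕ.*-cancelˡ-≡ k k′ n (begin
  n * k                          ≡⟨ sum-const n k ⟨
  sum {n} (λ _ → k)              ≡⟨ sum-cong-≗ (OutDesign.degree D) ⟨
  sum (λ i → sum (λ j → N i j))  ≡⟨ ∑-comm N ⟩
  sum (λ j → sum (λ i → N i j))  ≡⟨ sum-cong-≗ (OutDesign.degree D′) ⟩
  sum {n} (λ _ → k′)             ≡⟨ sum-const n k′ ⟩
  n * k′                         ∎)

-- Double counting of the pairs (j , m) with i → m ← j.
common-count : ∀ {n} {N : Matrix n n} {k l l′} → Is01 N → .{{_ : NonZero k}} → n ≡ 1 + (k + k) → Fin n →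
               OutDesign N k l → OutDesign (N ᵀ) k l′ → k ≡ 1 + (l + l)
common-count {n} {N} {k} {l} N01 n≡ i D D′ =
  ℕ.*-cancelˡ-≡ k (1 + (l + l)) k (ℕ.+-cancelʳ-≡ l _ _ (begin
    k * k + l                                             ≡⟨ cong (_+ l) total ⟨
    sum (gram N i) + l                                    ≡⟨ cong (sum (gram N i) +_) (sum-*I (λ _ → l) i) ⟨
    sum (gram N i) + sum (λ j → l * I i j)                ≡⟨ ∑-distrib-+ (gram N i) (λ j → l * I i j) ⟨
    sum (λ j → gram N i j + l * I i j)                    ≡⟨ sum-cong-≗ entry ⟩
    sum (λ j → l + k * I i j)                             ≡⟨ ∑-distrib-+ (λ _ → l) (λ j → k * I i j) ⟩
    sum {n} (λ _ → l) + sum (λ j → k * I i j)             ≡⟨ cong₂ _+_ (sum-const n l) (sum-*I (λ _ → k) i) ⟩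
    n * l + k                                             ≡⟨ cong (λ m → m * l + k) n≡ ⟩
    (1 + (k + k)) * l + k                                 ≡⟨ rearrange k l ⟩
    k * (1 + (l + l)) + l                                 ∎))
  where
  rearrange : ∀ k l → (1 + (k + k)) * l + k ≡ k * (1 + (l + l)) + l
  rearrange = solve-∀

  -- This is `N Nᵀ = (k - l) I + l J` without subtraction, which is why `l` is added to both sides
  -- of the count.
  entry : ∀ j → gram N i j + l * I i j ≡ l + k * I i j
  entry j with i Fin.≟ j
  ... | yes refl = begin
    gram N i i + l * 1  ≡⟨ cong₂ _+_ (trans (gram-diagonal N01 i) (OutDesign.degree D i)) (ℕ.*-identityʳ l) ⟩
    k + l               ≡⟨ ℕ.+-comm k l ⟩
    l + k               ≡⟨ cong (l +_) (ℕ.*-identityʳ k) ⟨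
    l + k * 1           ∎
  ... | no i≢j = cong₂ _+_ (OutDesign.common D i≢j) (trans (ℕ.*-zeroʳ l) (sym (ℕ.*-zeroʳ k)))

  -- Each of the `k` out-neighbours `m` of `i` has in-degree `k`.
  total : sum (gram N i) ≡ k * k
  total = begin
    sum (λ j → sum (λ m → N i m * N j m))    ≡⟨ ∑-comm (λ j m → N i m * N j m) ⟩
    sum (λ m → sum (λ j → N i m * N j m))    ≡⟨ sum-cong-≗ (λ m → *-distribˡ-sum (N i m) ((N ᵀ) m)) ⟨
    sum (λ m → N i m * sum ((N ᵀ) m))        ≡⟨ sum-cong-≗ (λ m → trans (cong (N i m *_) (OutDesign.degree D′ m)) (ℕ.*-comm (N i m) k)) ⟩
    sum (λ m → k * N i m)                    ≡⟨ *-distribˡ-sum k (N i) ⟨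
    k * sum (N i)                            ≡⟨ cong (k *_) (OutDesign.degree D i) ⟩
    k * k                                    ∎

-- The two designs may start with different parameters. Counting arcs gives `k′ = k`; then
-- `common-count`, applied to `N` and to `N ᵀ`, gives `1 + 2l = k = 1 + 2l′`.
doublyRegular : ∀ {n} {N : Matrix n n} {k k′ l l′} → 1 < n → Tournament N →
                OutDesign N k l → OutDesign (N ᵀ) k′ l′ → DoublyRegular N k l
doublyRegular {suc (suc n)} {N} {k} {k′} {l} {l′} (s<s z<s) T D D′ with degree-unique D D′
... | refl = record
  { tournament = T
  ; out-design = D
  ; in-design  = subst (OutDesign (N ᵀ) k) l′≡l D′
  ; k≡1+2l     = k≡
  ; n≡1+2k     = n≡
  }
  where
  n≡ : suc (suc n) ≡ 1 + (k + k)
  n≡ = begin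
    suc (suc n)                               ≡⟨ tournament-total T zero ⟨
    sum (N zero) + sum ((N ᵀ) zero) + 1       ≡⟨ cong (_+ 1) (cong₂ _+_ (OutDesign.degree D zero) (OutDesign.degree D′ zero)) ⟩
    k + k + 1                                 ≡⟨ ℕ.+-comm (k + k) 1 ⟩
    1 + (k + k)                               ∎

  -- Degree 0 would leave a single vertex.
  positive : ∀ k → suc (suc n) ≡ 1 + (k + k) → 0 < k
  positive (suc k) _ = z<s

  instance
    k-nonZero : NonZero k
    k-nonZero = >-nonZero (positive k n≡)

  k≡ : k ≡ 1 + (l + l)
  k≡ = common-count (tournament-01 T) n≡ zero D D′

  k≡′ : k ≡ 1 + (l′ + l′)
  k≡′ = common-count (λ i j → tournament-01 T j i) n≡ zero D′ D

  double-injective : ∀ a b → a + a ≡ b + b → a ≡ b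
  double-injective a b eq = ℕ.*-cancelˡ-≡ a b 2
    (trans (cong (a +_) (ℕ.+-identityʳ a)) (trans eq (cong (b +_) (sym (ℕ.+-identityʳ b)))))

  l′≡l : l′ ≡ l
  l′≡l = double-injective l′ l (ℕ.suc-injective (trans (sym k≡′) k≡))

-- Non-symmetric schemes with two classes

ι-injective : ∀ {a b} → ι a ≡ ι b → a ≡ b
ι-injective {a} {b} eq with ℚ./-injective-≃ (mkℚᵘ (pos a) 0) (mkℚᵘ (pos b) 0) eq
... | *≡* a1≡b1 = ℤ.+-injective (trans (sym (ℤ.*-identityʳ (pos a))) (trans a1≡b1 (ℤ.*-identityʳ (pos b))))

module _ {n : ℕ} (S : AssociationScheme 2 n) where
  open AssociationScheme S

  -- The coefficients depend on `i` and `j` alone, so the entry is a function of the three numbers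
  -- `A k x y`. The equality is obtained in ℚ, where the coefficients live, and pulled back along
  -- `ι`.
  constant-on-relations : ∀ i j {x y x′ y′} → (∀ k → A k x y ≡ A k x′ y′) → (A i · A j) x y ≡ (A i · A j) x′ y′
  constant-on-relations i j {x} {y} {x′} {y′} same with product i j
  ... | p , eq = ι-injective (begin
    ι ((A i · A j) x y)    ≡⟨ eq x y ⟩
    _                      ≡⟨ cong₂ (λ a b → p zero ℚ.* ι a ℚ.+ b) (same zero)
                               (cong₂ (λ a b → p (suc zero) ℚ.* ι a ℚ.+ b) (same (suc zero))
                                 (cong (λ a → p (suc (suc zero)) ℚ.* ι a ℚ.+ 0ℚ) (same (suc (suc zero))))) ⟩
    _                      ≡⟨ eq x′ y′ ⟨
    ι ((A i · A j) x′ y′)  ∎)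

  A₁ A₂ : Matrix n n
  A₁ = A (suc zero)
  A₂ = A (suc (suc zero))

  total : ∀ x y → I x y + (A₁ x y + (A₂ x y + 0)) ≡ 1
  total x y = trans (cong (_+ (A₁ x y + (A₂ x y + 0))) (sym (A₀≐I x y))) (sum≐J x y)

  -- If `A₁ ᵀ` were `A₀`, the diagonal entry at the given point would be covered twice. If it were
  -- `A₁`, then `A₂ = J - I - A₁` would be symmetric as well, and so would the whole scheme.
  transpose-swaps : Fin n → NonSymmetric S → A₁ ᵀ ≐ A₂
  transpose-swaps x nonSym with transpose (suc zero)
  ... | zero , A₁ᵀ≐A₀ = contradiction
    (trans (sym (total x x)) (cong₂ (λ a b → a + (b + (A₂ x x + 0))) (I-diagonal x)
       (trans (A₁ᵀ≐A₀ x x) (trans (A₀≐I x x) (I-diagonal x))))) λ ()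
  ... | suc zero , A₁ᵀ≐A₁ = contradiction symmetric nonSym
    where
    symmetric : ∀ i → A i ᵀ ≐ A i
    symmetric zero x y = trans (A₀≐I y x) (trans (I-sym y x) (sym (A₀≐I x y)))
    symmetric (suc zero) = A₁ᵀ≐A₁
    symmetric (suc (suc zero)) x y = ℕ.+-cancelʳ-≡ 0 _ _ (ℕ.+-cancelˡ-≡ (A₁ x y) _ _ (ℕ.+-cancelˡ-≡ (I x y) _ _ (begin
      I x y + (A₁ x y + (A₂ y x + 0))  ≡⟨ cong₂ (λ a b → a + (b + (A₂ y x + 0))) (I-sym x y) (sym (A₁ᵀ≐A₁ x y)) ⟩
      I y x + (A₁ y x + (A₂ y x + 0))  ≡⟨ trans (total y x) (sym (total x y)) ⟩
      I x y + (A₁ x y + (A₂ x y + 0))  ∎)))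
  ... | suc (suc zero) , A₁ᵀ≐A₂ = A₁ᵀ≐A₂

  module _ (A₁ᵀ≐A₂ : A₁ ᵀ ≐ A₂) where

    scheme-tournament : Tournament A₁
    scheme-tournament = record { arc = λ x y → begin
      A₁ x y + A₁ y x + I x y          ≡⟨ cong (λ a → A₁ x y + a + I x y) (A₁ᵀ≐A₂ x y) ⟩
      A₁ x y + A₂ x y + I x y          ≡⟨ rearrange (A₁ x y) (A₂ x y) (I x y) ⟩
      I x y + (A₁ x y + (A₂ x y + 0))  ≡⟨ total x y ⟩
      1                                ∎ }
      where
      rearrange : ∀ a b c → a + b + c ≡ c + (a + (b + 0))
      rearrange = solve-∀

    private
      T = scheme-tournament

      entries : ∀ {x y} → A₁ x y ≡ 1 → (A zero x y ≡ 0) × (A₂ x y ≡ 0)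
      entries {x} {y} A₁xy =
        trans (A₀≐I x y) (ℕ.m+n≡0⇒m≡0 _ rest) , ℕ.m+n≡0⇒n≡0 (I x y) rest
        where
        rearrange : ∀ a b → a + (1 + (b + 0)) ≡ 1 + (a + b)
        rearrange = solve-∀

        rest : I x y + A₂ x y ≡ 0
        rest = ℕ.suc-injective (trans (sym (rearrange (I x y) (A₂ x y)))
          (trans (cong (λ a → I x y + (a + (A₂ x y + 0))) (sym A₁xy)) (total x y)))

      same-diagonal : ∀ x y k → A k x x ≡ A k y y
      same-diagonal x y zero = trans (A₀≐I x x) (trans (trans (I-diagonal x) (sym (I-diagonal y))) (sym (A₀≐I y y)))
      same-diagonal x y (suc zero) = trans (tournament-diagonal T x) (sym (tournament-diagonal T y))
      same-diagonal x y (suc (suc zero)) = trans (sym (A₁ᵀ≐A₂ x x)) (trans (same-diagonal x y (suc zero)) (A₁ᵀ≐A₂ y y))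

      same-arc : ∀ {x y x′ y′} → A₁ x y ≡ 1 → A₁ x′ y′ ≡ 1 → ∀ k → A k x y ≡ A k x′ y′
      same-arc p q zero with entries p | entries q
      ... | a , _ | b , _ = trans a (sym b)
      same-arc p q (suc zero) = trans p (sym q)
      same-arc p q (suc (suc zero)) with entries p | entries q
      ... | _ , a | _ , b = trans a (sym b)

      -- The parameters are read off at one pair `a`, `b`. Every other pair of distinct vertices is
      -- joined by an arc in one direction, and symmetry of `gram M` lets either pair be turned
      -- round until the two arcs correspond.
      design : ∀ {M : Matrix n n} i j → Is01 M → gram M ≐ A i · A j → ∀ {a b} → a ≢ b → OutDesign M (sum (M a)) (gram M a b)
      design {M} i j M01 eq {a} {b} a≢b = record
        { degree = λ x → begin
            sum (M x)         ≡⟨ gram-diagonal M01 x ⟨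
            gram M x x        ≡⟨ eq x x ⟩
            (A i · A j) x x   ≡⟨ constant-on-relations i j (same-diagonal x a) ⟩
            (A i · A j) a a   ≡⟨ eq a a ⟨
            gram M a a        ≡⟨ gram-diagonal M01 a ⟩
            sum (M a)         ∎
        ; common = common′
        }
        where
        arc : ∀ {x y x′ y′} → A₁ x y ≡ 1 → A₁ x′ y′ ≡ 1 → gram M x y ≡ gram M x′ y′
        arc {x} {y} {x′} {y′} p q = trans (eq x y) (trans (constant-on-relations i j (same-arc p q)) (sym (eq x′ y′)))

        common′ : ∀ {x y} → x ≢ y → gram M x y ≡ gram M a b
        common′ {x} {y} x≢y with tournament-orient T x≢y | tournament-orient T a≢b
        ... | inj₁ p | inj₁ q = arc p q
        ... | inj₁ p | inj₂ q = trans (arc p q) (gram-sym M b a)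
        ... | inj₂ p | inj₁ q = trans (gram-sym M x y) (arc p q)
        ... | inj₂ p | inj₂ q = trans (gram-sym M x y) (trans (arc p q) (gram-sym M b a))

    scheme-doublyRegular : 1 < n → ∃₂ (DoublyRegular A₁)
    scheme-doublyRegular 1<n@(s<s z<s) = _ , _ , doublyRegular 1<n T
      -- `A₁ A₁ᵀ = A₁ A₂` governs the out-neighbours, `A₁ᵀ A₁ = A₂ A₁` the in-neighbours.
      (design (suc zero) (suc (suc zero)) (zero-one (suc zero))
        (λ x y → sum-cong-≗ (λ m → cong (A₁ x m *_) (A₁ᵀ≐A₂ m y))) {zero} {suc zero} λ ())
      (design (suc (suc zero)) (suc zero) (λ x y → zero-one (suc zero) y x)
        (λ x y → sum-cong-≗ (λ m → cong (_* A₁ m y) (A₁ᵀ≐A₂ x m))) {zero} {suc zero} λ ())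

-- The sign structure of C₁

-- These properties hold for `C₁` built from any tournament; double regularity enters only with
-- `SkewCover`. By `skew`, column `x` is row `σ x` written vertically.
record Skew {r} (C : Matrix r r) (σ : Fin r → Fin r) (n : ℕ) : Set where
  field
    zero-one     : Is01 C
    diagonal     : ∀ x → C x x ≡ 0
    involutive   : ∀ x → σ (σ x) ≡ x
    fixpointfree : ∀ x → σ x ≢ x
    skew         : ∀ x y → C y x ≡ C (σ x) y
    complement   : ∀ {x y} → x ≢ y → σ x ≢ y → C x y + C (σ x) y ≡ 1
    degree       : ∀ x → sum (C x) ≡ n

  -- `skew` turns the column index into a row index and back, so `C` commutes with the permutation
  -- `σ`.
  σ-adjoint : ∀ x y → C x (σ y) ≡ C (σ x) y
  σ-adjoint x y = begin
    C x (σ y)      ≡⟨ skew (σ y) x ⟩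
    C (σ (σ y)) x  ≡⟨ cong (λ z → C z x) (involutive y) ⟩
    C y x          ≡⟨ skew x y ⟩
    C (σ x) y      ∎

  antidiagonal : ∀ x → C (σ x) x ≡ 0
  antidiagonal x = trans (sym (skew x x)) (diagonal x)

  antidiagonal′ : ∀ x → C x (σ x) ≡ 0
  antidiagonal′ x = trans (σ-adjoint x x) (antidiagonal x)

  -- Four naturals with sum 1 leave no room for two ones, which is how `disjoint` follows.
  -- Multiplied by an entry of another row, the identity yields `gram-complement`.
  row-total : ∀ x y → C x y + C (σ x) y + (I x y + I (σ x) y) ≡ 1
  row-total x y with x Fin.≟ y | σ x Fin.≟ y
  ... | yes refl | yes σx≡x = contradiction σx≡x (fixpointfree x)
  ... | yes refl | no  _    = cong (_+ 1) (cong₂ _+_ (diagonal x) (antidiagonal x))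
  ... | no  _    | yes refl = cong (_+ 1) (cong₂ _+_ (antidiagonal′ x) (diagonal (σ x)))
  ... | no  x≢y  | no  σx≢y = cong (_+ 0) (complement x≢y σx≢y)

  disjoint : ∀ x y → C x y * C (σ x) y ≡ 0
  disjoint x y with C x y | C (σ x) y | row-total x y
  ... | zero        | _     | _  = refl
  ... | suc zero    | zero  | _  = refl
  ... | suc zero    | suc _ | ()
  ... | suc (suc _) | _     | ()

  gram-σ : ∀ x → gram C x (σ x) ≡ 0
  gram-σ x = sum-zero (disjoint x)

  -- The rows y and σ y are disjoint and together miss only the columns y and σ y.
  gram-complement : ∀ {x y} → x ≢ y → σ x ≢ y → gram C x y + gram C x (σ y) + 1 ≡ n
  gram-complement {x} {y} x≢y σx≢y = begin
    gram C x y + gram C x (σ y) + 1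
      ≡⟨ cong (gram C x y + gram C x (σ y) +_) at-y ⟨
    gram C x y + gram C x (σ y) + (sum (λ l → C x l * I y l) + sum (λ l → C x l * I (σ y) l))
      ≡⟨ cong₂ _+_ (∑-distrib-+ (λ l → C x l * C y l) (λ l → C x l * C (σ y) l))
                   (∑-distrib-+ (λ l → C x l * I y l) (λ l → C x l * I (σ y) l)) ⟨
    sum (λ l → C x l * C y l + C x l * C (σ y) l) + sum (λ l → C x l * I y l + C x l * I (σ y) l)
      ≡⟨ ∑-distrib-+ (λ l → C x l * C y l + C x l * C (σ y) l) (λ l → C x l * I y l + C x l * I (σ y) l) ⟨
    sum (λ l → C x l * C y l + C x l * C (σ y) l + (C x l * I y l + C x l * I (σ y) l))
      ≡⟨ sum-cong-≗ entry ⟩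
    sum (C x)
      ≡⟨ degree x ⟩
    n ∎
    where
    -- Row `x` contains exactly one of the columns `y` and `σ y`; this is the 1 in the statement.
    at-y : sum (λ l → C x l * I y l) + sum (λ l → C x l * I (σ y) l) ≡ 1
    at-y = trans (cong₂ _+_ (sum-*I (C x) y) (sum-*I (C x) (σ y)))
      (trans (cong (C x y +_) (σ-adjoint x y)) (complement x≢y σx≢y))

    factor : ∀ a b c d e → a * b + a * c + (a * d + a * e) ≡ a * (b + c + (d + e))
    factor = solve-∀

    entry : ∀ l → C x l * C y l + C x l * C (σ y) l + (C x l * I y l + C x l * I (σ y) l) ≡ C x l
    entry l = trans (factor (C x l) (C y l) (C (σ y) l) (I y l) (I (σ y) l))
      (trans (cong (C x l *_) (row-total y l)) (ℕ.*-identityʳ (C x l)))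

-- For `C₁` the number `μ` is the out-degree `k` of the tournament. Positivity of `μ` is what makes
-- common neighbours, and hence short walks, exist.
record SkewCover {r} (C : Matrix r r) (σ : Fin r → Fin r) (n μ : ℕ) : Set where
  field
    isSkew : Skew C σ n
    common : ∀ {x y} → x ≢ y → σ x ≢ y → gram C x y ≡ μ
    n≡1+2μ : n ≡ 1 + (μ + μ)
    r≡2+2n : r ≡ 2 + (n + n)
    0<μ    : 0 < μ

  open Skew isSkew public

-- Adding a source to the tournament

border : ∀ {n} → Matrix n n → Matrix (suc n) (suc n)
border N zero    zero    = 0
border N zero    (suc j) = 1
border N (suc i) zero    = 0
border N (suc i) (suc j) = N i j

border-tournament : ∀ {n} {N : Matrix n n} → Tournament N → Tournament (border N)
border-tournament {N = N} T = record { arc = arc }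
  where
  arc : ∀ i j → border N i j + border N j i + I i j ≡ 1
  arc zero    zero    = refl
  arc zero    (suc j) = refl
  arc (suc i) zero    = refl
  arc (suc i) (suc j) = Tournament.arc T i j

-- Orthogonality of rows `p` and `q` of `W - Wᵀ`: they agree on `k` of the `2k` remaining vertices.
-- The source shares `k` out-neighbours and no in-neighbour with an old vertex. Two old vertices
-- share `l` out-neighbours and `l` in-neighbours, and the source is one more common in-neighbour,
-- so the count is `l + (1 + l) = k`.
border-gram : ∀ {n} {N : Matrix n n} {k l} → DoublyRegular N k l → ∀ {p q} → p ≢ q →
              gram (border N) p q + gram (border N ᵀ) p q ≡ k
border-gram {N = N} {k} {l} D {p} {q} = go p q
  where
  open DoublyRegular D
  row : ∀ j → sum (λ m → N j m + 0) ≡ k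
  row j = trans (sum-cong-≗ (λ m → ℕ.+-identityʳ (N j m))) (OutDesign.degree out-design j)

  row′ : ∀ j → sum (λ m → N j m * 1) ≡ k
  row′ j = trans (sum-cong-≗ (λ m → ℕ.*-identityʳ (N j m))) (OutDesign.degree out-design j)

  go : ∀ p q → p ≢ q → gram (border N) p q + gram (border N ᵀ) p q ≡ k
  go zero    zero    p≢q = contradiction refl p≢q
  go zero    (suc j) p≢q = trans (cong₂ _+_ (row j) (sum-zero {f = λ m → 0 * N m j} (λ _ → refl))) (ℕ.+-identityʳ k)
  go (suc i) zero    p≢q = trans (cong₂ _+_ (row′ i) (sum-zero (λ m → ℕ.*-zeroʳ (N m i)))) (ℕ.+-identityʳ k)
  go (suc i) (suc j) p≢q = trans
    (cong₂ (λ a b → a + (1 + b)) (OutDesign.common out-design (p≢q ∘ cong suc)) (OutDesign.common in-design (p≢q ∘ cong suc)))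
    (trans (ℕ.+-suc l l) (sym k≡1+2l))

twist : ∀ {m} → Bool → Bool → Matrix m m → Matrix m m
twist true  true  W = W
twist true  false W = W ᵀ
twist false true  W = W ᵀ
twist false false W = W

-- Signed coordinates for the rows and columns of `C₁`

module _ {n : ℕ} where

  -- The block rows of C₁ are, in order, (0, true), (i, true), (i, false) and (0, false).
  encode : Fin (suc n) → Bool → Fin (1 + (n + (n + 1)))
  encode zero    true  = zero
  encode (suc i) true  = suc (i ↑ˡ (n + 1))
  encode (suc i) false = suc (n ↑ʳ (i ↑ˡ 1))
  encode zero    false = suc (n ↑ʳ (n ↑ʳ zero))

  decode : Fin (1 + (n + (n + 1))) → Fin (suc n) × Bool
  decode zero = zero , true
  decode (suc x) with splitAt n x
  ... | inj₁ i = suc i , true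
  ... | inj₂ y with splitAt n y
  ...   | inj₁ i = suc i , false
  ...   | inj₂ _ = zero , false

  decode-encode : ∀ p s → decode (encode p s) ≡ (p , s)
  decode-encode zero    true  = refl
  decode-encode (suc i) true  rewrite Fin.splitAt-↑ˡ n i (n + 1) = refl
  decode-encode (suc i) false rewrite Fin.splitAt-↑ʳ n (n + 1) (i ↑ˡ 1) | Fin.splitAt-↑ˡ n i 1 = refl
  decode-encode zero    false rewrite Fin.splitAt-↑ʳ n (n + 1) (n ↑ʳ zero) | Fin.splitAt-↑ʳ n 1 zero = refl

  data Encoded : Fin (1 + (n + (n + 1))) → Set where
    encoded : ∀ p s → Encoded (encode p s)

  view : ∀ x → Encoded x
  view zero = encoded zero true
  view (suc x) with splitAt n x in eq
  ... | inj₁ i rewrite sym (Fin.splitAt⁻¹-↑ˡ eq) = encoded (suc i) true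
  ... | inj₂ y with splitAt n y in eq′
  ...   | inj₁ i rewrite sym (Fin.splitAt⁻¹-↑ʳ {m = n} eq) | sym (Fin.splitAt⁻¹-↑ˡ eq′) = encoded (suc i) false
  ...   | inj₂ zero rewrite sym (Fin.splitAt⁻¹-↑ʳ {m = n} eq) | sym (Fin.splitAt⁻¹-↑ʳ {m = n} eq′) = encoded zero false

  antipode : Fin (1 + (n + (n + 1))) → Fin (1 + (n + (n + 1)))
  antipode x = encode (proj₁ (decode x)) (not (proj₂ (decode x)))

  antipode-encode : ∀ p s → antipode (encode p s) ≡ encode p (not s)
  antipode-encode p s rewrite decode-encode p s = refl

  sum-encode : ∀ f → sum f ≡ sum (λ p → f (encode p true) + f (encode p false))
  sum-encode f = begin
    f₀ + sum (f ∘ suc)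
      ≡⟨ cong (f₀ +_) (trans (sum-↑ n (f ∘ suc)) (cong (sum a +_) (sum-↑ n (λ y → f (suc (n ↑ʳ y)))))) ⟩
    f₀ + (sum a + (sum b + (f∞ + 0)))
      ≡⟨ rearrange f₀ (sum a) (sum b) f∞ ⟩
    f₀ + f∞ + (sum a + sum b)
      ≡⟨ cong (f₀ + f∞ +_) (∑-distrib-+ a b) ⟨
    f₀ + f∞ + sum (λ i → a i + b i) ∎
    where
    f₀ f∞ : ℕ
    f₀ = f (encode zero true)
    f∞ = f (encode zero false)

    a b : Vector ℕ n
    a i = f (encode (suc i) true)
    b i = f (encode (suc i) false)

    rearrange : ∀ x y z w → x + (y + (z + (w + 0))) ≡ x + w + (y + z)
    rearrange = solve-∀

  private
    split-a : ∀ i → splitAt n (i ↑ˡ (n + 1)) ≡ inj₁ i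
    split-a i = Fin.splitAt-↑ˡ n i (n + 1)

    split-bc : ∀ y → splitAt n (n ↑ʳ y) ≡ inj₂ y
    split-bc = Fin.splitAt-↑ʳ n (n + 1)

    split-b : ∀ i → splitAt n (i ↑ˡ 1) ≡ inj₁ i
    split-b i = Fin.splitAt-↑ˡ n i 1

    split-c : splitAt n (n ↑ʳ zero {0}) ≡ inj₂ zero
    split-c = Fin.splitAt-↑ʳ n 1 zero

  -- One case for each of the sixteen blocks. The hypothesis is spent on the two inner blocks of
  -- opposite signs, where `C₁` has `N′` and the twisted border has `N ᵀ`; the constant blocks are
  -- the arcs at the source.
  C₁-encode : ∀ {N N′ : Matrix n n} → N ᵀ ≐ N′ → ∀ p s q t →
              C₁ N N′ (encode p s) (encode q t) ≡ twist s t (border N) p q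
  C₁-encode h zero    true  zero    true  = refl
  C₁-encode h zero    true  (suc j) true  rewrite split-a j = refl
  C₁-encode h zero    true  (suc j) false rewrite split-bc (j ↑ˡ 1) | split-b j = refl
  C₁-encode h zero    true  zero    false rewrite split-bc (n ↑ʳ zero) | split-c = refl
  C₁-encode h (suc i) true  zero    true  rewrite split-a i = refl
  C₁-encode h (suc i) true  (suc j) true  rewrite split-a i | split-a j = refl
  C₁-encode h (suc i) true  (suc j) false rewrite split-a i | split-bc (j ↑ˡ 1) | split-b j = sym (h i j)
  C₁-encode h (suc i) true  zero    false rewrite split-a i | split-bc (n ↑ʳ zero) | split-c = refl
  C₁-encode h (suc i) false zero    true  rewrite split-bc (i ↑ˡ 1) | split-b i = refl
  C₁-encode h (suc i) false (suc j) true  rewrite split-bc (i ↑ˡ 1) | split-b i | split-a j = sym (h i j)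
  C₁-encode h (suc i) false (suc j) false rewrite split-bc (i ↑ˡ 1) | split-b i | split-bc (j ↑ˡ 1) | split-b j = refl
  C₁-encode h (suc i) false zero    false rewrite split-bc (i ↑ˡ 1) | split-b i | split-bc (n ↑ʳ zero) | split-c = refl
  C₁-encode h zero    false zero    true  rewrite split-bc (n ↑ʳ zero) | split-c = refl
  C₁-encode h zero    false (suc j) true  rewrite split-bc (n ↑ʳ zero) | split-c | split-a j = refl
  C₁-encode h zero    false (suc j) false rewrite split-bc (n ↑ʳ zero) | split-c | split-bc (j ↑ˡ 1) | split-b j = refl
  C₁-encode h zero    false zero    false rewrite split-bc (n ↑ʳ zero) | split-c | split-bc (n ↑ʳ zero) | split-c = refl

  module _ {N N′ : Matrix n n} (h : N ᵀ ≐ N′) where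
    private
      C = C₁ N N′
      W = border N

    C₁-skew : Tournament N → Skew C antipode n
    C₁-skew T = record
      { zero-one     = C₁-01 (tournament-01 T) (λ i j → subst (λ a → a ≡ 0 ⊎ a ≡ 1) (h i j) (tournament-01 T j i))
      ; diagonal     = diagonal
      ; involutive   = involutive
      ; fixpointfree = fixpointfree
      ; skew         = skew
      ; complement   = complement
      ; degree       = degree
      }
      where
      TW : Tournament W
      TW = border-tournament T

      diagonal : ∀ x → C x x ≡ 0
      diagonal x with view x
      ... | encoded p true  = trans (C₁-encode h p true p true) (tournament-diagonal TW p)
      ... | encoded p false = trans (C₁-encode h p false p false) (tournament-diagonal TW p)

      involutive : ∀ x → antipode (antipode x) ≡ x
      involutive x with view x
      ... | encoded p s = trans (cong antipode (antipode-encode p s))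
        (trans (antipode-encode p (not s)) (cong (encode p) (not-involutive s)))

      fixpointfree : ∀ x → antipode x ≢ x
      fixpointfree x eq with view x
      ... | encoded p s = not-¬ refl (sym (cong proj₂ (begin
        (p , not s)                     ≡⟨ decode-encode p (not s) ⟨
        decode (encode p (not s))       ≡⟨ cong decode (trans (sym (antipode-encode p s)) eq) ⟩
        decode (encode p s)             ≡⟨ decode-encode p s ⟩
        (p , s)                         ∎)))

      twist-skew : ∀ s t p q → twist t s W q p ≡ twist (not s) t W p q
      twist-skew true  true  p q = refl
      twist-skew true  false p q = refl
      twist-skew false true  p q = refl
      twist-skew false false p q = refl

      C-antipode : ∀ p s q t → C (antipode (encode p s)) (encode q t) ≡ twist (not s) t W p q
      C-antipode p s q t = trans (cong (λ z → C z (encode q t)) (antipode-encode p s)) (C₁-encode h p (not s) q t)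

      skew : ∀ x y → C y x ≡ C (antipode x) y
      skew x y with view x | view y
      ... | encoded p s | encoded q t =
        trans (C₁-encode h q t p s) (trans (twist-skew s t p q) (sym (C-antipode p s q t)))

      twist-complement : ∀ s t {p q} → p ≢ q → twist s t W p q + twist (not s) t W p q ≡ 1
      twist-complement true  true  p≢q = tournament-≢ TW p≢q
      twist-complement true  false p≢q = tournament-≢ TW (p≢q ∘ sym)
      twist-complement false true  p≢q = tournament-≢ TW (p≢q ∘ sym)
      twist-complement false false p≢q = tournament-≢ TW p≢q

      complement : ∀ {x y} → x ≢ y → antipode x ≢ y → C x y + C (antipode x) y ≡ 1
      complement {x} {y} x≢y σx≢y with view x | view y
      ... | encoded p s | encoded q t =
        trans (cong₂ _+_ (C₁-encode h p s q t) (C-antipode p s q t)) (twist-complement s t (p≢q s t x≢y σx≢y))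
        where
        p≢q : ∀ s t → encode p s ≢ encode q t → antipode (encode p s) ≢ encode q t → p ≢ q
        p≢q true  true  ne₁ ne₂ refl = ne₁ refl
        p≢q true  false ne₁ ne₂ refl = ne₂ (antipode-encode p true)
        p≢q false true  ne₁ ne₂ refl = ne₂ (antipode-encode p false)
        p≢q false false ne₁ ne₂ refl = ne₁ refl

      -- The columns of both signs together list the out- and in-neighbours of `p`, that is, all `n`
      -- other vertices of the bordered tournament.
      twist-degree : ∀ s p → sum (λ q → twist s true W p q + twist s false W p q) ≡ n
      twist-degree true p = ℕ.+-cancelʳ-≡ 1 _ _ (trans (cong (_+ 1) (∑-distrib-+ (W p) ((W ᵀ) p)))
        (trans (tournament-total TW p) (ℕ.+-comm 1 n)))
      twist-degree false p = trans (sum-cong-≗ (λ q → ℕ.+-comm (W q p) (W p q))) (twist-degree true p)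

      degree : ∀ x → sum (C x) ≡ n
      degree x with view x
      ... | encoded p s = begin
        sum (C (encode p s))                                                              ≡⟨ sum-encode (C (encode p s)) ⟩
        sum (λ q → C (encode p s) (encode q true) + C (encode p s) (encode q false))      ≡⟨ sum-cong-≗ (λ q → cong₂ _+_ (C₁-encode h p s q true) (C₁-encode h p s q false)) ⟩
        sum (λ q → twist s true W p q + twist s false W p q)                              ≡⟨ twist-degree s p ⟩
        n                                                                                 ∎

    C₁-skewCover : ∀ {k l} → DoublyRegular N k l → SkewCover C antipode n k
    C₁-skewCover {k} {l} D = record
      { isSkew = isSkew
      ; common = common
      ; n≡1+2μ = n≡1+2k
      ; r≡2+2n = size n
      ; 0<μ    = subst (0 <_) (sym k≡1+2l) z<s
      }
      where
      open DoublyRegular D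
      isSkew : Skew C antipode n
      isSkew = C₁-skew tournament

      open Skew isSkew

      size : ∀ n → 1 + (n + (n + 1)) ≡ 2 + (n + n)
      size = solve-∀

      gram-encode : ∀ p s q t → gram C (encode p s) (encode q t) ≡
        sum (λ m → twist s true W p m * twist t true W q m + twist s false W p m * twist t false W q m)
      gram-encode p s q t = trans (sum-encode (λ z → C (encode p s) z * C (encode q t) z)) (sum-cong-≗ (λ m → cong₂ _+_
        (cong₂ _*_ (C₁-encode h p s m true) (C₁-encode h q t m true))
        (cong₂ _*_ (C₁-encode h p s m false) (C₁-encode h q t m false))))

      same-sign : ∀ s {p q} → p ≢ q → gram C (encode p s) (encode q s) ≡ k
      same-sign true {p} {q} p≢q = trans (gram-encode p true q true)
        (trans (∑-distrib-+ (λ m → W p m * W q m) (λ m → W m p * W m q)) (border-gram D p≢q))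
      same-sign false {p} {q} p≢q = trans (gram-encode p false q false)
        (trans (∑-distrib-+ (λ m → W m p * W m q) (λ m → W p m * W q m))
          (trans (ℕ.+-comm (gram (W ᵀ) p q) (gram W p q)) (border-gram D p≢q)))

      -- Obtained from `same-sign` by complement: of the `n = 1 + 2k` columns in row `x`, `k` are
      -- shared with row `y` and one is `y` or its antipode, so `k` remain for the antipodal row.
      opposite-sign : ∀ s {p q} → encode p s ≢ encode q s → antipode (encode p s) ≢ encode q s →
                      p ≢ q → gram C (encode p s) (encode q (not s)) ≡ k
      opposite-sign s {p} {q} ne₁ ne₂ p≢q =
        ℕ.+-cancelʳ-≡ 1 _ _ (ℕ.+-cancelˡ-≡ k _ _ (begin
          k + (gram C x y′ + 1)              ≡⟨ ℕ.+-assoc k _ 1 ⟨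
          k + gram C x y′ + 1                ≡⟨ cong₂ (λ a z → a + gram C x z + 1) (same-sign s p≢q) (antipode-encode q s) ⟨
          gram C x y + gram C x (antipode y) + 1  ≡⟨ gram-complement ne₁ ne₂ ⟩
          n                                  ≡⟨ n≡1+2k ⟩
          1 + (k + k)                        ≡⟨ rearrange k ⟩
          k + (k + 1)                        ∎))
        where
        x = encode p s
        y = encode q s
        y′ = encode q (not s)
        rearrange : ∀ k → 1 + (k + k) ≡ k + (k + 1)
        rearrange = solve-∀

      encode-injective : ∀ {p s q t} → encode p s ≡ encode q t → p ≡ q
      encode-injective {p} {s} {q} {t} eq = cong proj₁ (trans (sym (decode-encode p s)) (trans (cong decode eq) (decode-encode q t)))

      common : ∀ {x y} → x ≢ y → antipode x ≢ y → gram C x y ≡ k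
      common {x} {y} x≢y σx≢y with view x | view y
      ... | encoded p s | encoded q t with p Fin.≟ q
      common x≢y σx≢y | encoded p true  | encoded q true  | yes refl = contradiction refl x≢y
      common x≢y σx≢y | encoded p true  | encoded q false | yes refl = contradiction (antipode-encode p true) σx≢y
      common x≢y σx≢y | encoded p false | encoded q true  | yes refl = contradiction (antipode-encode p false) σx≢y
      common x≢y σx≢y | encoded p false | encoded q false | yes refl = contradiction refl x≢y
      common x≢y σx≢y | encoded p true  | encoded q true  | no p≢q = same-sign true p≢q
      common x≢y σx≢y | encoded p false | encoded q false | no p≢q = same-sign false p≢q
      common x≢y σx≢y | encoded p true  | encoded q false | no p≢q = opposite-sign true (p≢q ∘ encode-injective)
        (λ eq → p≢q (encode-injective (trans (sym (antipode-encode p true)) eq))) p≢q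
      common x≢y σx≢y | encoded p false | encoded q true  | no p≢q = opposite-sign false (p≢q ∘ encode-injective)
        (λ eq → p≢q (encode-injective (trans (sym (antipode-encode p false)) eq))) p≢q

-- Cardinalities of tabulated subsets as sums

indicator : Bool → ℕ
indicator b = if b then 1 else 0

∣tabulate∣ : ∀ {v} (f : Fin v → Bool) → ∣ tabulate f ∣ ≡ sum (indicator ∘ f)
∣tabulate∣ {zero}  f = refl
∣tabulate∣ {suc v} f with f zero
... | true  = cong suc (∣tabulate∣ (f ∘ suc))
... | false = ∣tabulate∣ (f ∘ suc)

∣tabulate∩tabulate∣ : ∀ {v} (f g : Fin v → Bool) →
                      ∣ tabulate f ∩ tabulate g ∣ ≡ sum (λ i → indicator (f i) * indicator (g i))
∣tabulate∩tabulate∣ {zero}  f g = refl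
∣tabulate∩tabulate∣ {suc v} f g with f zero | g zero
... | true  | true  = cong suc (∣tabulate∩tabulate∣ (f ∘ suc) (g ∘ suc))
... | true  | false = ∣tabulate∩tabulate∣ (f ∘ suc) (g ∘ suc)
... | false | _     = ∣tabulate∩tabulate∣ (f ∘ suc) (g ∘ suc)

indicator-≟1 : ∀ {a} → a ≡ 0 ⊎ a ≡ 1 → indicator (does (a ℕ.≟ 1)) ≡ a
indicator-≟1 (inj₁ refl) = refl
indicator-≟1 (inj₂ refl) = refl

*-positive : ∀ {a b} → a ≡ 0 ⊎ a ≡ 1 → b ≡ 0 ⊎ b ≡ 1 → 0 < a * b → a ≡ 1 × b ≡ 1
*-positive (inj₁ refl) _           ()
*-positive (inj₂ refl) (inj₁ refl) ()
*-positive (inj₂ refl) (inj₂ refl) _ = refl , refl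

0≢1 : ∀ {a} → a ≡ 0 → a ≢ 1
0≢1 refl ()

-- Common neighbours and short paths in a skew cover

module SkewCoverProperties {r n μ : ℕ} {C : Matrix r r} {σ : Fin r → Fin r} (cover : SkewCover C σ n μ) where
  open SkewCover cover public

  σ-swap : ∀ {x y} → σ x ≡ y → x ≡ σ y
  σ-swap {x} refl = sym (involutive x)

  σ-injective : ∀ {x y} → σ x ≡ σ y → x ≡ y
  σ-injective {y = y} eq = trans (σ-swap eq) (involutive y)

  0<n : 0 < n
  0<n = subst (0 <_) (sym n≡1+2μ) z<s

  n∸1≡2μ : n ∸ 1 ≡ μ + μ
  n∸1≡2μ = cong (_∸ 1) n≡1+2μ

  n∸1≡μ*2 : n ∸ 1 ≡ μ * 2
  n∸1≡μ*2 = trans n∸1≡2μ (rearrange μ)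
    where
    rearrange : ∀ a → a + a ≡ a * 2
    rearrange = solve-∀

  half : (n ∸ 1) / 2 ≡ μ
  half = trans (cong (_/ 2) n∸1≡μ*2) (m*n/n≡m μ 2)

  gram-refl : ∀ x → gram C x x ≡ n
  gram-refl x = trans (gram-diagonal zero-one x) (degree x)

  gram-σ′ : ∀ x → gram C (σ x) x ≡ 0
  gram-σ′ x = trans (gram-sym C (σ x) x) (gram-σ x)

  some-neighbour : ∀ x → ∃ λ y → C x y ≡ 1
  some-neighbour x with sum-positive (C x) (subst (0 <_) (sym (degree x)) 0<n)
  ... | y , 0<Cxy with zero-one x y
  ...   | inj₁ Cxy≡0 = contradiction (subst (0 <_) Cxy≡0 0<Cxy) λ ()
  ...   | inj₂ Cxy≡1 = y , Cxy≡1

  common-neighbour : ∀ {x y} → x ≢ y → σ x ≢ y → ∃ λ z → C x z ≡ 1 × C y z ≡ 1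
  common-neighbour {x} {y} x≢y σx≢y
    with sum-positive (λ z → C x z * C y z) (subst (0 <_) (sym (common x≢y σx≢y)) 0<μ)
  ... | z , 0<CC = z , *-positive (zero-one x z) (zero-one y z) 0<CC

  neighbour-≢ : ∀ {x y} → C x y ≡ 1 → x ≢ y × σ x ≢ y
  neighbour-≢ {x} Cxy≡1 = (λ { refl → 0≢1 (diagonal x) Cxy≡1 }) , (λ { refl → 0≢1 (antidiagonal′ x) Cxy≡1 })

  data Position (x y : Fin r) : Set where
    base      : x ≡ y → Position x y
    antipodal : σ x ≡ y → Position x y
    generic   : x ≢ y → σ x ≢ y → Position x y

  position : ∀ x y → Position x y
  position x y with x Fin.≟ y | σ x Fin.≟ y
  ... | yes x≡y | _        = base x≡y
  ... | no _    | yes σx≡y = antipodal σx≡y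
  ... | no x≢y  | no σx≢y  = generic x≢y σx≢y

  -- By `skew`, the rows through column `y` are indexed by the columns in row `σ y`. Among these,
  -- `z` is chosen so as to lie in row `x` or row `σ x` too; both rows miss the columns `x` and
  -- `σ x`, so `z` differs from both.
  column-neighbour : ∀ x y → ∃ λ z → C z y ≡ 1 × x ≢ z × σ x ≢ z
  column-neighbour x y with position x y
  ... | base refl = let z , p = some-neighbour (σ x) ; a , b = neighbour-≢ p in
        z , trans (skew x z) p , (λ x≡z → b (trans (involutive x) x≡z)) , a
  ... | antipodal refl = let z , p = some-neighbour x ; a , b = neighbour-≢ p in
        z , trans (skew (σ x) z) (trans (cong (λ w → C w z) (involutive x)) p) , a , b
  ... | generic x≢y σx≢y = let z , p , q = common-neighbour {x} {σ y} (λ eq → σx≢y (sym (σ-swap (sym eq)))) (x≢y ∘ σ-injective) in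
        z , trans (skew y z) q , neighbour-≢ p

  -- The last edge is chosen first: its row `z` is generic with respect to `x`, so a common
  -- neighbour `w` closes the gap.
  three-path : ∀ x y → ∃₂ λ w z → C x w ≡ 1 × C z w ≡ 1 × C z y ≡ 1
  three-path x y with column-neighbour x y
  ... | z , Czy , x≢z , σx≢z with common-neighbour x≢z σx≢z
  ...   | w , Cxw , Czw = w , z , Cxw , Czw , Czy

  columns-gram : ∀ x y → sum (λ z → C z y * C x z) ≡ gram C (σ y) x
  columns-gram x y = sum-cong-≗ (λ z → cong (_* C x z) (skew y z))

-- Row `x` of `C ᵀ` is row `σ x` of `C`, so each property is the old one with the rows permuted by
-- `σ`.
skewCover-ᵀ : ∀ {r n μ} {C : Matrix r r} {σ : Fin r → Fin r} → SkewCover C σ n μ → SkewCover (C ᵀ) σ n μ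
skewCover-ᵀ {C = C} {σ} cover = record
  { isSkew = record
    { zero-one     = λ x y → zero-one y x
    ; diagonal     = diagonal
    ; involutive   = involutive
    ; fixpointfree = fixpointfree
    ; skew         = λ x y → trans (skew y x) (sym (σ-adjoint y x))
    ; complement   = λ {x} {y} x≢y σx≢y → begin
        C y x + C y (σ x)    ≡⟨ cong₂ _+_ (skew x y) (trans (σ-adjoint y x) (sym (skew y x))) ⟩
        C (σ x) y + C x y    ≡⟨ ℕ.+-comm (C (σ x) y) (C x y) ⟩
        C x y + C (σ x) y    ≡⟨ complement x≢y σx≢y ⟩
        1                    ∎
    ; degree       = λ x → trans (sum-cong-≗ (skew x)) (degree (σ x))
    }
  ; common = λ {x} {y} x≢y σx≢y → trans
      (sum-cong-≗ (λ z → cong₂ _*_ (skew x z) (skew y z)))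
      (common (x≢y ∘ σ-injective) (σx≢y ∘ σ-injective))
  ; n≡1+2μ = n≡1+2μ
  ; r≡2+2n = r≡2+2n
  ; 0<μ    = 0<μ
  }
  where open SkewCoverProperties cover

-- The bipartite graph of a square 0/1 matrix

module Bipartition {r : ℕ} (C : Matrix r r) (adj : IsAdjacencyMatrix (B C)) where

  Γ : Graph
  Γ = fromAdjacencyMatrix (B C) adj

  open Graph Γ

  vertex : Bool → Fin r → Vertex
  vertex true  x = x ↑ˡ r
  vertex false x = r ↑ʳ x

  block : Bool → Matrix r r
  block true  = C
  block false = C ᵀ

  glue : ∀ {A : Set} → (Bool → Fin r → A) → Vertex → A
  glue f w = [ f true , f false ]′ (splitAt r w)

  glue-vertex : ∀ {A : Set} (f : Bool → Fin r → A) s x → glue f (vertex s x) ≡ f s x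
  glue-vertex f true  x = cong [ f true , f false ]′ (Fin.splitAt-↑ˡ r x r)
  glue-vertex f false x = cong [ f true , f false ]′ (Fin.splitAt-↑ʳ r r x)

  side : Vertex → Bool
  side = glue const

  side-vertex : ∀ s x → side (vertex s x) ≡ s
  side-vertex = glue-vertex const

  vertex-injective : ∀ s {x y} → vertex s x ≡ vertex s y → x ≡ y
  vertex-injective true  = Fin.↑ˡ-injective r _ _
  vertex-injective false = Fin.↑ʳ-injective r _ _

  -- Sides are named relative to `s`, so that one argument covers base points among the rows and
  -- among the columns.
  data SideView (s : Bool) : Vertex → Set where
    same     : ∀ x → SideView s (vertex s x)
    opposite : ∀ x → SideView s (vertex (not s) x)

  sideView : ∀ s w → SideView s w
  sideView s w with splitAt r w in eq
  sideView true  w | inj₁ x rewrite sym (Fin.splitAt⁻¹-↑ˡ eq) = same x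
  sideView true  w | inj₂ x rewrite sym (Fin.splitAt⁻¹-↑ʳ {m = r} eq) = opposite x
  sideView false w | inj₁ x rewrite sym (Fin.splitAt⁻¹-↑ˡ eq) = opposite x
  sideView false w | inj₂ x rewrite sym (Fin.splitAt⁻¹-↑ʳ {m = r} eq) = same x

  data VertexView : Vertex → Set where
    at : ∀ s x → VertexView (vertex s x)

  vertexView : ∀ w → VertexView w
  vertexView w with sideView true w
  ... | same x     = at true x
  ... | opposite x = at false x

  B-same : ∀ s x y → B C (vertex s x) (vertex s y) ≡ 0
  B-same true  x y rewrite Fin.splitAt-↑ˡ r x r | Fin.splitAt-↑ˡ r y r = refl
  B-same false x y rewrite Fin.splitAt-↑ʳ r r x | Fin.splitAt-↑ʳ r r y = refl

  B-opposite : ∀ s x y → B C (vertex s x) (vertex (not s) y) ≡ block s x y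
  B-opposite true  x y rewrite Fin.splitAt-↑ˡ r x r | Fin.splitAt-↑ʳ r r y = refl
  B-opposite false x y rewrite Fin.splitAt-↑ʳ r r x | Fin.splitAt-↑ˡ r y r = refl

  forth : ∀ s {x y} → block s x y ≡ 1 → vertex s x ~ vertex (not s) y
  forth s {x} {y} = trans (B-opposite s x y)

  back : ∀ s {x y} → block s x y ≡ 1 → vertex (not s) y ~ vertex s x
  back s xy = ~-sym {vertex s _} (forth s xy)

  edge-inversion : ∀ s {x w} → vertex s x ~ w → ∃ λ y → w ≡ vertex (not s) y × block s x y ≡ 1
  edge-inversion s {x} {w} x~w with sideView s w
  ... | same y     = contradiction x~w (0≢1 (B-same s x y))
  ... | opposite y = y , refl , trans (sym (B-opposite s x y)) x~w

  edge-side : ∀ {u w} → u ~ w → side w ≡ not (side u)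
  edge-side {u} u~w with vertexView u
  ... | at s x with edge-inversion s {x} u~w
  ...   | y , refl , _ = trans (side-vertex (not s) y) (cong not (sym (side-vertex s x)))

  -- The parity of a length as iterated negation; on numerals it reduces, so a walk of wrong parity
  -- contradicts `not-¬` directly.
  flips : ℕ → Bool → Bool
  flips zero    b = b
  flips (suc ℓ) b = flips ℓ (not b)

  walk-side : ∀ {ℓ u w} → Walk ℓ u w → side w ≡ flips ℓ (side u)
  walk-side nil = refl
  walk-side (cons {ℓ} u~v p) = trans (walk-side p) (cong (flips ℓ) (edge-side u~v))

  walk-parity : ∀ s t {ℓ x y} → Walk ℓ (vertex s x) (vertex t y) → t ≡ flips ℓ s
  walk-parity s t {ℓ} {x} {y} p =
    trans (sym (side-vertex t y)) (trans (walk-side p) (cong (flips ℓ) (side-vertex s x)))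

  walk₀-inversion : ∀ {u w} → Walk 0 u w → u ≡ w
  walk₀-inversion nil = refl

  walk₁-inversion : ∀ s {x y} → Walk 1 (vertex s x) (vertex (not s) y) → block s x y ≡ 1
  walk₁-inversion s {x} {y} (cons x~y nil) = trans (sym (B-opposite s x y)) x~y

  walk₂-inversion : ∀ s {x y} → Walk 2 (vertex s x) (vertex s y) → ∃ λ z → block s x z ≡ 1 × block s y z ≡ 1
  walk₂-inversion s {x} {y} (cons x~w (cons w~y nil)) with edge-inversion s {x} x~w
  ... | z , refl , xz = z , xz , trans (sym (B-opposite s y z)) (~-sym {vertex (not s) z} w~y)

  sum-sides : ∀ s f → sum f ≡ sum (λ x → f (vertex s x)) + sum (λ x → f (vertex (not s) x))
  sum-sides true  f = sum-↑ r f
  sum-sides false f = trans (sum-↑ r f) (ℕ.+-comm (sum (λ x → f (vertex true x))) _)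

  B-indicator : ∀ u w → indicator (does (u ~? w)) ≡ B C u w
  B-indicator u w = indicator-≟1 (IsAdjacencyMatrix.zero-one adj u w)

  sum-row : ∀ s x (g : Vertex → ℕ) → sum (λ w → B C (vertex s x) w * g w) ≡ sum (λ y → block s x y * g (vertex (not s) y))
  sum-row s x g = trans (sum-sides s _) (cong₂ _+_
    (sum-zero (λ y → cong (_* g (vertex s y)) (B-same s x y)))
    (sum-cong-≗ (λ y → cong (_* g (vertex (not s) y)) (B-opposite s x y))))

  ∣neighbours∣ : ∀ s x → ∣ neighbours (vertex s x) ∣ ≡ sum (block s x)
  ∣neighbours∣ s x = begin
    ∣ neighbours (vertex s x) ∣                   ≡⟨ ∣tabulate∣ (λ w → does (vertex s x ~? w)) ⟩
    sum (λ w → indicator (does (vertex s x ~? w)))  ≡⟨ sum-cong-≗ (λ w → trans (B-indicator (vertex s x) w) (sym (ℕ.*-identityʳ _))) ⟩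
    sum (λ w → B C (vertex s x) w * 1)            ≡⟨ sum-row s x (λ _ → 1) ⟩
    sum (λ y → block s x y * 1)                   ≡⟨ sum-cong-≗ (λ y → ℕ.*-identityʳ (block s x y)) ⟩
    sum (block s x)                               ∎

  ∣neighbours∩_∣ : ∀ (f : Vertex → Bool) s x → ∣ neighbours (vertex s x) ∩ tabulate f ∣ ≡
                   sum (λ y → block s x y * indicator (f (vertex (not s) y)))
  ∣neighbours∩ f ∣ s x = begin
    ∣ neighbours (vertex s x) ∩ tabulate f ∣
      ≡⟨ ∣tabulate∩tabulate∣ (λ w → does (vertex s x ~? w)) f ⟩
    sum (λ w → indicator (does (vertex s x ~? w)) * indicator (f w))
      ≡⟨ sum-cong-≗ (λ w → cong (_* indicator (f w)) (B-indicator (vertex s x) w)) ⟩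
    sum (λ w → B C (vertex s x) w * indicator (f w))
      ≡⟨ sum-row s x (indicator ∘ f) ⟩
    sum (λ y → block s x y * indicator (f (vertex (not s) y))) ∎

  -- A row of `block (not s)` is a column of `block s`. Counts around vertices of the far side can
  -- thus be stated with the matrix of the base point.
  ∣neighbours∩_∣ᵀ : ∀ (f : Vertex → Bool) s y → ∣ neighbours (vertex (not s) y) ∩ tabulate f ∣ ≡
                    sum (λ x → block s x y * indicator (f (vertex s x)))
  ∣neighbours∩ f ∣ᵀ true  = ∣neighbours∩ f ∣ false
  ∣neighbours∩ f ∣ᵀ false = ∣neighbours∩ f ∣ true

  bipartite : Bipartite Γ
  bipartite = side , λ {x} {y} x~y eq → not-¬ refl (trans eq (edge-side {x} {y} x~y))

-- Distances and distribution diagrams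

module SkewCoverGraph {r n μ : ℕ} {C : Matrix r r} {σ : Fin r → Fin r} (cover : SkewCover C σ n μ)
                      (adj : IsAdjacencyMatrix (B C)) where
  open Bipartition C adj
  open Graph Γ

  block-cover : ∀ s → SkewCover (block s) σ n μ
  block-cover true  = cover
  block-cover false = skewCover-ᵀ cover

  module Block (s : Bool) = SkewCoverProperties (block-cover s)
  open SkewCoverProperties cover using (half; n∸1≡2μ; n∸1≡μ*2; r≡2+2n; involutive; fixpointfree; Position; base; antipodal; generic; position)

  distance₀ : ∀ s x → Distance (vertex s x) (vertex s x) 0
  distance₀ s x = nil , λ ()

  distance₁ : ∀ s {x y} → block s x y ≡ 1 → Distance (vertex s x) (vertex (not s) y) 1
  distance₁ s xy = cons (forth s xy) nil , λ { (s≤s z≤n) p → not-¬ refl (sym (walk-parity s (not s) p)) }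

  distance₂ : ∀ s {x y} → x ≢ y → σ x ≢ y → Distance (vertex s x) (vertex s y) 2
  distance₂ s {x} {y} x≢y σx≢y with Block.common-neighbour s x≢y σx≢y
  ... | z , xz , yz = cons (forth s xz) (cons (back s yz) nil) , shorter
    where
    shorter : ∀ {ℓ} → ℓ < 2 → ¬ Walk ℓ (vertex s x) (vertex s y)
    shorter {0} _ p = x≢y (vertex-injective s (walk₀-inversion p))
    shorter {1} _ p = not-¬ refl (walk-parity s s p)
    shorter {suc (suc _)} (s≤s (s≤s ()))

  distance₃ : ∀ s {x y} → block s x y ≢ 1 → Distance (vertex s x) (vertex (not s) y) 3
  distance₃ s {x} {y} xy≢1 with Block.three-path s x y
  ... | w , z , xw , zw , zy = cons (forth s xw) (cons (back s zw) (cons (forth s zy) nil)) , shorter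
    where
    shorter : ∀ {ℓ} → ℓ < 3 → ¬ Walk ℓ (vertex s x) (vertex (not s) y)
    shorter {0} _ p = not-¬ refl (sym (walk-parity s (not s) p))
    shorter {1} _ p = xy≢1 (walk₁-inversion s p)
    shorter {2} _ p = not-¬ refl (walk-parity s (not s) p)
    shorter {suc (suc (suc _))} (s≤s (s≤s (s≤s ())))

  antipodes-disjoint : ∀ s {x z} → block s x z ≡ 1 → block s (σ x) z ≢ 1
  antipodes-disjoint s {x} {z} xz σxz = contradiction
    (trans (sym (cong₂ _*_ xz σxz)) (Block.disjoint s x z)) λ ()

  -- A neighbour `y` of `σ x` is reached in three steps. Shorter walks fail by parity, or because
  -- length two would need a column in both of the disjoint rows `x` and `σ x`.
  distance₄ : ∀ s x → Distance (vertex s x) (vertex s (σ x)) 4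
  distance₄ s x with Block.some-neighbour s (σ x)
  ... | y , σxy with Block.three-path s x y
  ...   | w , z , xw , zw , zy =
    cons (forth s xw) (cons (back s zw) (cons (forth s zy) (cons (back s σxy) nil))) , shorter
    where
    shorter : ∀ {ℓ} → ℓ < 4 → ¬ Walk ℓ (vertex s x) (vertex s (σ x))
    shorter {0} _ p = fixpointfree x (sym (vertex-injective s (walk₀-inversion p)))
    shorter {1} _ p = not-¬ refl (walk-parity s s p)
    shorter {2} _ p with walk₂-inversion s p
    ... | z , xz , σxz = antipodes-disjoint s xz σxz
    shorter {3} _ p = not-¬ refl (trans (walk-parity s s p) (not-involutive (not s)))
    shorter {suc (suc (suc (suc _)))} (s≤s (s≤s (s≤s (s≤s ()))))

  distances : ∀ u w → ∃ λ e → e ≤ 4 × Distance u w e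
  distances u w with vertexView u
  ... | at s x with sideView s w
  ...   | opposite y with block s x y ℕ.≟ 1
  ...     | yes xy   = 1 , s≤s z≤n , distance₁ s xy
  ...     | no  xy≢1 = 3 , s≤s (s≤s (s≤s z≤n)) , distance₃ s xy≢1
  distances u w | at s x | same y with position x y
  ...     | base refl          = 0 , z≤n , distance₀ s x
  ...     | antipodal refl     = 4 , ℕ.≤-refl , distance₄ s x
  ...     | generic x≢y σx≢y   = 2 , s≤s (s≤s z≤n) , distance₂ s x≢y σx≢y

  connected : Connected Γ
  connected u w with distances u w
  ... | e , _ , p , _ = e , p

  diameter : Diameter Γ 4
  -- Any row and its antipode attain 4; `r≡2+2n` provides a row.
  diameter = distances , _ , _ , distance₄ true (subst Fin (sym r≡2+2n) zero)

  amplyRegular : AmplyRegular Γ (4 * (n + 1)) n 0 ((n ∸ 1) / 2)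
  amplyRegular = record
    { order≡v  = trans (cong (λ a → a + a) r≡2+2n) (size n)
    ; regular  = regular
    ; adjacent = adjacent
    ; distance = distance
    }
    where
    size : ∀ n → 2 + (n + n) + (2 + (n + n)) ≡ 4 * (n + 1)
    size = solve-∀

    regular : ∀ u → ∣ neighbours u ∣ ≡ n
    regular u with vertexView u
    ... | at s x = trans (∣neighbours∣ s x) (Block.degree s x)

    adjacent : ∀ u w → u ~ w → ∣ neighbours u ∩ neighbours w ∣ ≡ 0
    adjacent u w u~w with vertexView u
    ... | at s x with edge-inversion s {x} {w} u~w
    ...   | y , refl , _ = trans (∣neighbours∩ (λ z → does (vertex (not s) y ~? z)) ∣ s x)
      (sum-zero (λ z → trans (cong (block s x z *_)
        (trans (B-indicator (vertex (not s) y) (vertex (not s) z)) (B-same (not s) y z))) (ℕ.*-zeroʳ (block s x z))))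

    distance : ∀ u w → Distance u w 2 → ∣ neighbours u ∩ neighbours w ∣ ≡ (n ∸ 1) / 2
    distance u w (p , shortest) with vertexView u
    ... | at s x with sideView s w
    ...   | opposite y = contradiction (sym (trans (walk-parity s (not s) p) (not-involutive s))) (not-¬ refl)
    ...   | same y = trans (∣neighbours∩ (λ z → does (vertex s y ~? z)) ∣ s x) (begin
      sum (λ z → block s x z * indicator (does (vertex s y ~? vertex (not s) z)))
        ≡⟨ sum-cong-≗ (λ z → cong (block s x z *_) (trans (B-indicator (vertex s y) (vertex (not s) z)) (B-opposite s y z))) ⟩
      gram (block s) x y
        ≡⟨ Block.common s (λ { refl → shortest z<s nil }) σx≢y ⟩
      μ
        ≡⟨ half ⟨
      (n ∸ 1) / 2 ∎)
      where
      σx≢y : σ x ≢ y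
      σx≢y refl with walk₂-inversion s p
      ... | z , xz , σxz = antipodes-disjoint s xz σxz

  -- The equitable partition around a base vertex

  module Diagram (s : Bool) (x : Fin r) where
    open Block s using (diagonal; antidiagonal; antidiagonal′; σ-adjoint; complement; zero-one; degree; common;
      gram-σ; gram-σ′; gram-refl; columns-gram; σ-swap; σ-injective; some-neighbour; neighbour-≢)
    open DistributionDiagram (𝒬 n) using (size; quotient)

    E : Matrix r r
    E = block s

    samePart : Fin r → Fin 6
    samePart z = if does (x Fin.≟ z) then 0F else if does (σ x Fin.≟ z) then 4F else 2F

    -- All columns outside row `x` are at distance three from the base; adjacency to the antipode
    -- separates `P₃` from `P₅`.
    oppositePart : Fin r → Fin 6
    oppositePart y = if does (E x y ℕ.≟ 1) then 1F else if does (E (σ x) y ℕ.≟ 1) then 3F else 5F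

    data OppositePosition (y : Fin r) : Set where
      near : E x y ≡ 1 → E (σ x) y ≡ 0 → OppositePosition y
      far  : E x y ≡ 0 → E (σ x) y ≡ 1 → OppositePosition y

    oppositePosition : ∀ {y} → x ≢ y → σ x ≢ y → OppositePosition y
    oppositePosition {y} x≢y σx≢y with zero-one x y
    ... | inj₁ xy≡0 = far xy≡0 (trans (cong (_+ E (σ x) y) (sym xy≡0)) (complement x≢y σx≢y))
    ... | inj₂ xy≡1 = near xy≡1 (ℕ.suc-injective (trans (cong (_+ E (σ x) y) (sym xy≡1)) (complement x≢y σx≢y)))

    samePart-base : samePart x ≡ 0F
    samePart-base rewrite dec-true (x Fin.≟ x) refl = refl

    samePart-antipodal : samePart (σ x) ≡ 4F
    samePart-antipodal rewrite dec-false (x Fin.≟ σ x) (fixpointfree x ∘ sym) | dec-true (σ x Fin.≟ σ x) refl = refl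

    samePart-generic : ∀ {z} → x ≢ z → σ x ≢ z → samePart z ≡ 2F
    samePart-generic {z} x≢z σx≢z rewrite dec-false (x Fin.≟ z) x≢z | dec-false (σ x Fin.≟ z) σx≢z = refl

    oppositePart-near : ∀ {y} → E x y ≡ 1 → oppositePart y ≡ 1F
    oppositePart-near xy≡1 rewrite xy≡1 = refl

    oppositePart-far : ∀ {y} → E x y ≡ 0 → E (σ x) y ≡ 1 → oppositePart y ≡ 3F
    oppositePart-far xy≡0 σxy≡1 rewrite xy≡0 | σxy≡1 = refl

    oppositePart-none : ∀ {y} → E x y ≡ 0 → E (σ x) y ≡ 0 → oppositePart y ≡ 5F
    oppositePart-none xy≡0 σxy≡0 rewrite xy≡0 | σxy≡0 = refl

    -- `P₂` is written as the sum of rows `x` and `σ x`, evaluated at a row index: by `complement`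
    -- this is 1 exactly away from `x` and `σ x`. In this form edge counts become sums of `gram`
    -- entries.
    sameIndicator : Fin 6 → Fin r → ℕ
    sameIndicator 0F z = I x z
    sameIndicator 2F z = E x z + E (σ x) z
    sameIndicator 4F z = I (σ x) z
    sameIndicator _  z = 0

    oppositeIndicator : Fin 6 → Fin r → ℕ
    oppositeIndicator 1F y = E x y
    oppositeIndicator 3F y = E (σ x) y
    oppositeIndicator 5F y = I x y + I (σ x) y
    oppositeIndicator _  y = 0

    samePart-indicator : ∀ j z → indicator (does (samePart z Fin.≟ j)) ≡ sameIndicator j z
    samePart-indicator j z with position x z
    samePart-indicator j z | base refl rewrite samePart-base = go j
      where
      go : ∀ j → indicator (does (0F Fin.≟ j)) ≡ sameIndicator j x
      go 0F = sym (I-diagonal x)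
      go 1F = refl
      go 2F = sym (cong₂ _+_ (diagonal x) (antidiagonal x))
      go 3F = refl
      go 4F = sym (I-≢ (fixpointfree x))
      go 5F = refl
    samePart-indicator j z | antipodal refl rewrite samePart-antipodal = go j
      where
      go : ∀ j → indicator (does (4F Fin.≟ j)) ≡ sameIndicator j (σ x)
      go 0F = sym (I-≢ (fixpointfree x ∘ sym))
      go 1F = refl
      go 2F = sym (cong₂ _+_ (antidiagonal′ x) (diagonal (σ x)))
      go 3F = refl
      go 4F = sym (I-diagonal (σ x))
      go 5F = refl
    samePart-indicator j z | generic x≢z σx≢z rewrite samePart-generic x≢z σx≢z = go j
      where
      go : ∀ j → indicator (does (2F Fin.≟ j)) ≡ sameIndicator j z
      go 0F = sym (I-≢ x≢z)
      go 1F = refl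
      go 2F = sym (complement x≢z σx≢z)
      go 3F = refl
      go 4F = sym (I-≢ σx≢z)
      go 5F = refl

    oppositePart-indicator : ∀ j y → indicator (does (oppositePart y Fin.≟ j)) ≡ oppositeIndicator j y
    oppositePart-indicator j y with position x y
    oppositePart-indicator j y | base refl rewrite oppositePart-none (diagonal x) (antidiagonal x) = go j
      where
      go : ∀ j → indicator (does (5F Fin.≟ j)) ≡ oppositeIndicator j x
      go 0F = refl
      go 1F = sym (diagonal x)
      go 2F = refl
      go 3F = sym (antidiagonal x)
      go 4F = refl
      go 5F = sym (cong₂ _+_ (I-diagonal x) (I-≢ (fixpointfree x)))
    oppositePart-indicator j y | antipodal refl rewrite oppositePart-none (antidiagonal′ x) (diagonal (σ x)) = go j
      where
      go : ∀ j → indicator (does (5F Fin.≟ j)) ≡ oppositeIndicator j (σ x)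
      go 0F = refl
      go 1F = sym (antidiagonal′ x)
      go 2F = refl
      go 3F = sym (diagonal (σ x))
      go 4F = refl
      go 5F = sym (cong₂ _+_ (I-≢ (fixpointfree x ∘ sym)) (I-diagonal (σ x)))
    oppositePart-indicator j y | generic x≢y σx≢y with oppositePosition x≢y σx≢y
    ... | near xy σxy rewrite oppositePart-near xy = go j
      where
      go : ∀ j → indicator (does (1F Fin.≟ j)) ≡ oppositeIndicator j y
      go 0F = refl
      go 1F = sym xy
      go 2F = refl
      go 3F = sym σxy
      go 4F = refl
      go 5F = sym (cong₂ _+_ (I-≢ x≢y) (I-≢ σx≢y))
    ... | far xy σxy rewrite oppositePart-far xy σxy = go j
      where
      go : ∀ j → indicator (does (3F Fin.≟ j)) ≡ oppositeIndicator j y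
      go 0F = refl
      go 1F = sym xy
      go 2F = refl
      go 3F = sym σxy
      go 4F = refl
      go 5F = sym (cong₂ _+_ (I-≢ x≢y) (I-≢ σx≢y))

    sameCount : Fin r → Fin 6 → ℕ
    sameCount z j = sum (λ y → E z y * oppositeIndicator j y)

    oppositeCount : Fin r → Fin 6 → ℕ
    oppositeCount y j = sum (λ z → E z y * sameIndicator j z)

    no-edges : (f : Vector ℕ r) → sum (λ y → f y * 0) ≡ 0
    no-edges f = sum-zero (λ y → ℕ.*-zeroʳ (f y))

    sameCount-5 : ∀ z → sameCount z 5F ≡ E z x + E z (σ x)
    sameCount-5 z = begin
      sum (λ y → E z y * (I x y + I (σ x) y))                    ≡⟨ sum-cong-≗ (λ y → ℕ.*-distribˡ-+ (E z y) (I x y) (I (σ x) y)) ⟩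
      sum (λ y → E z y * I x y + E z y * I (σ x) y)              ≡⟨ ∑-distrib-+ (λ y → E z y * I x y) (λ y → E z y * I (σ x) y) ⟩
      sum (λ y → E z y * I x y) + sum (λ y → E z y * I (σ x) y)  ≡⟨ cong₂ _+_ (sum-*I (E z) x) (sum-*I (E z) (σ x)) ⟩
      E z x + E z (σ x)                                          ∎

    oppositeCount-2 : ∀ y → oppositeCount y 2F ≡ gram E (σ y) x + gram E (σ y) (σ x)
    oppositeCount-2 y = begin
      sum (λ z → E z y * (E x z + E (σ x) z))                    ≡⟨ sum-cong-≗ (λ z → ℕ.*-distribˡ-+ (E z y) (E x z) (E (σ x) z)) ⟩
      sum (λ z → E z y * E x z + E z y * E (σ x) z)              ≡⟨ ∑-distrib-+ (λ z → E z y * E x z) (λ z → E z y * E (σ x) z) ⟩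
      sum (λ z → E z y * E x z) + sum (λ z → E z y * E (σ x) z)  ≡⟨ cong₂ _+_ (columns-gram x y) (columns-gram (σ x) y) ⟩
      gram E (σ y) x + gram E (σ y) (σ x)                        ∎

    sameCount-quotient : ∀ z j → sameCount z j ≡ quotient (samePart z) j
    sameCount-quotient z j with position x z
    sameCount-quotient z j | base refl rewrite samePart-base = go j
      where
      go : ∀ j → sameCount x j ≡ quotient 0F j
      go 0F = no-edges (E x)
      go 1F = gram-refl x
      go 2F = no-edges (E x)
      go 3F = gram-σ x
      go 4F = no-edges (E x)
      go 5F = trans (sameCount-5 x) (cong₂ _+_ (diagonal x) (antidiagonal′ x))
    sameCount-quotient z j | antipodal refl rewrite samePart-antipodal = go j
      where
      go : ∀ j → sameCount (σ x) j ≡ quotient 4F j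
      go 0F = no-edges (E (σ x))
      go 1F = gram-σ′ x
      go 2F = no-edges (E (σ x))
      go 3F = gram-refl (σ x)
      go 4F = no-edges (E (σ x))
      go 5F = trans (sameCount-5 (σ x)) (cong₂ _+_ (antidiagonal x) (diagonal (σ x)))
    sameCount-quotient z j | generic x≢z σx≢z rewrite samePart-generic x≢z σx≢z = go j
      where
      go : ∀ j → sameCount z j ≡ quotient 2F j
      go 0F = no-edges (E z)
      go 1F = trans (gram-sym E z x) (trans (common x≢z σx≢z) (sym half))
      go 2F = no-edges (E z)
      go 3F = trans (gram-sym E z (σ x))
        (trans (common σx≢z (λ eq → x≢z (trans (sym (involutive x)) eq))) (sym half))
      go 4F = no-edges (E z)
      -- `E z (σ x)` equals `E (σ z) x`, and exactly one of the rows `z` and `σ z` contains column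
      -- `x`.
      go 5F = trans (sameCount-5 z) (trans (cong (E z x +_) (σ-adjoint z x))
        (complement (x≢z ∘ sym) (λ eq → σx≢z (sym (σ-swap eq)))))

    -- Serves `P₁` and `P₃` alike. Column `y` is row `σ y`, which is generic with respect to both
    -- `x` and `σ x`, so it meets each of these rows in `μ` columns.
    oppositeCount-2-generic : ∀ {y} → x ≢ y → σ x ≢ y → oppositeCount y 2F ≡ n ∸ 1
    oppositeCount-2-generic {y} x≢y σx≢y = begin
      oppositeCount y 2F                   ≡⟨ oppositeCount-2 y ⟩
      gram E (σ y) x + gram E (σ y) (σ x)  ≡⟨ cong₂ _+_ (common σy≢x σσy≢x) (common (x≢y ∘ sym ∘ σ-injective) σσy≢σx) ⟩
      μ + μ                                ≡⟨ n∸1≡2μ ⟨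
      n ∸ 1                                ∎
      where
      σy≢x : σ y ≢ x
      σy≢x eq = σx≢y (sym (σ-swap eq))

      σσy≢x : σ (σ y) ≢ x
      σσy≢x eq = x≢y (trans (sym eq) (involutive y))

      σσy≢σx : σ (σ y) ≢ σ x
      σσy≢σx eq = σx≢y (trans (sym eq) (involutive y))

    oppositeCount-quotient : ∀ y j → oppositeCount y j ≡ quotient (oppositePart y) j
    oppositeCount-quotient y j with position x y
    oppositeCount-quotient y j | base refl rewrite oppositePart-none (diagonal x) (antidiagonal x) = go j
      where
      go : ∀ j → oppositeCount x j ≡ quotient 5F j
      go 0F = trans (sum-*I (λ z → E z x) x) (diagonal x)
      go 1F = no-edges (λ z → E z x)
      -- Column `x` is row `σ x`: it is disjoint from row `x` and shares all `n` columns with row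
      -- `σ x`.
      go 2F = trans (oppositeCount-2 x) (cong₂ _+_ (gram-σ′ x) (gram-refl (σ x)))
      go 3F = no-edges (λ z → E z x)
      go 4F = trans (sum-*I (λ z → E z x) (σ x)) (antidiagonal x)
      go 5F = no-edges (λ z → E z x)
    oppositeCount-quotient y j | antipodal refl rewrite oppositePart-none (antidiagonal′ x) (diagonal (σ x)) = go j
      where
      go : ∀ j → oppositeCount (σ x) j ≡ quotient 5F j
      go 0F = trans (sum-*I (λ z → E z (σ x)) x) (antidiagonal′ x)
      go 1F = no-edges (λ z → E z (σ x))
      go 2F = trans (oppositeCount-2 (σ x)) (trans
        (cong (λ u → gram E u x + gram E u (σ x)) (involutive x))
        (trans (cong₂ _+_ (gram-refl x) (gram-σ x)) (ℕ.+-identityʳ n)))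
      go 3F = no-edges (λ z → E z (σ x))
      go 4F = trans (sum-*I (λ z → E z (σ x)) (σ x)) (diagonal (σ x))
      go 5F = no-edges (λ z → E z (σ x))
    oppositeCount-quotient y j | generic x≢y σx≢y with oppositePosition x≢y σx≢y
    ... | near xy σxy rewrite oppositePart-near xy = go j
      where
      go : ∀ j → oppositeCount y j ≡ quotient 1F j
      go 0F = trans (sum-*I (λ z → E z y) x) xy
      go 1F = no-edges (λ z → E z y)
      go 2F = oppositeCount-2-generic x≢y σx≢y
      go 3F = no-edges (λ z → E z y)
      go 4F = trans (sum-*I (λ z → E z y) (σ x)) σxy
      go 5F = no-edges (λ z → E z y)
    ... | far xy σxy rewrite oppositePart-far xy σxy = go j
      where
      go : ∀ j → oppositeCount y j ≡ quotient 3F j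
      go 0F = trans (sum-*I (λ z → E z y) x) xy
      go 1F = no-edges (λ z → E z y)
      go 2F = oppositeCount-2-generic x≢y σx≢y
      go 3F = no-edges (λ z → E z y)
      go 4F = trans (sum-*I (λ z → E z y) (σ x)) σxy
      go 5F = no-edges (λ z → E z y)

    -- Selects `a` when `t` is the base side and `b` otherwise, in a form that `glue` can take for
    -- both values of `s`.
    relative : ∀ {A : Set} → Bool → A → A → Bool → A
    relative true  a b t = if t then a else b
    relative false a b t = if t then b else a

    sidedPart : Bool → Fin r → Fin 6
    sidedPart t z = relative s (samePart z) (oppositePart z) t

    part : Vertex → Fin 6
    part = glue sidedPart

    part-same : ∀ z → part (vertex s z) ≡ samePart z
    part-same z = trans (glue-vertex sidedPart s z) (go s {samePart z} {oppositePart z})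
      where
      go : ∀ s {a b : Fin 6} → relative s a b s ≡ a
      go true  = refl
      go false = refl

    part-opposite : ∀ y → part (vertex (not s) y) ≡ oppositePart y
    part-opposite y = trans (glue-vertex sidedPart (not s) y) (go s {samePart y} {oppositePart y})
      where
      go : ∀ s {a b : Fin 6} → relative s a b (not s) ≡ b
      go true  = refl
      go false = refl

    same-cell : ∀ j z → indicator (does (part (vertex s z) Fin.≟ j)) ≡ sameIndicator j z
    same-cell j z = trans (cong (λ i → indicator (does (i Fin.≟ j))) (part-same z)) (samePart-indicator j z)

    opposite-cell : ∀ j y → indicator (does (part (vertex (not s) y) Fin.≟ j)) ≡ oppositeIndicator j y
    opposite-cell j y = trans (cong (λ i → indicator (does (i Fin.≟ j))) (part-opposite y)) (oppositePart-indicator j y)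

    nonempty : ∀ i → ∃ λ w → part w ≡ i
    nonempty 0F = vertex s x , trans (part-same x) samePart-base
    nonempty 1F = let y , xy = some-neighbour x in
      vertex (not s) y , trans (part-opposite y) (oppositePart-near xy)
    nonempty 2F = let y , xy = some-neighbour x ; x≢y , σx≢y = neighbour-≢ xy in
      vertex s y , trans (part-same y) (samePart-generic x≢y σx≢y)
    nonempty 3F with some-neighbour (σ x)
    ... | y , σxy with zero-one x y
    ...   | inj₁ xy≡0 = vertex (not s) y , trans (part-opposite y) (oppositePart-far xy≡0 σxy)
    ...   | inj₂ xy≡1 = contradiction σxy (antipodes-disjoint s xy≡1)
    nonempty 4F = vertex s (σ x) , trans (part-same (σ x)) samePart-antipodal
    nonempty 5F = vertex (not s) x , trans (part-opposite x) (oppositePart-none (diagonal x) (antidiagonal x))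

    partition : Partition order 6
    partition = record { part = part ; nonempty = nonempty }

    open Partition partition using (cell)

    ∈cell⇒ : ∀ {i w} → w ∈ cell i → part w ≡ i
    ∈cell⇒ {i} {w} w∈ with part w Fin.≟ i | trans (sym (lookup∘tabulate (λ w → does (part w Fin.≟ i)) w)) ([]=⇒lookup w∈)
    ... | yes eq | _ = eq

    ∈cell⇐ : ∀ {i w} → part w ≡ i → w ∈ cell i
    ∈cell⇐ {i} {w} eq = lookup⇒[]= w (cell i)
      (trans (lookup∘tabulate (λ w → does (part w Fin.≟ i)) w) (dec-true (part w Fin.≟ i) eq))

    equitable : Equitable Γ partition quotient
    equitable i j w w∈ with ∈cell⇒ {w = w} w∈ | sideView s w
    ... | refl | same z = begin
      ∣ neighbours (vertex s z) ∩ cell j ∣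
        ≡⟨ ∣neighbours∩ (λ w → does (part w Fin.≟ j)) ∣ s z ⟩
      sum (λ y → E z y * indicator (does (part (vertex (not s) y) Fin.≟ j)))
        ≡⟨ sum-cong-≗ (λ y → cong (E z y *_) (opposite-cell j y)) ⟩
      sameCount z j
        ≡⟨ sameCount-quotient z j ⟩
      quotient (samePart z) j
        ≡⟨ cong (λ i → quotient i j) (part-same z) ⟨
      quotient (part (vertex s z)) j ∎
    ... | refl | opposite y = begin
      ∣ neighbours (vertex (not s) y) ∩ cell j ∣
        ≡⟨ ∣neighbours∩ (λ w → does (part w Fin.≟ j)) ∣ᵀ s y ⟩
      sum (λ z → E z y * indicator (does (part (vertex s z) Fin.≟ j)))
        ≡⟨ sum-cong-≗ (λ z → cong (E z y *_) (same-cell j z)) ⟩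
      oppositeCount y j
        ≡⟨ oppositeCount-quotient y j ⟩
      quotient (oppositePart y) j
        ≡⟨ cong (λ i → quotient i j) (part-opposite y) ⟨
      quotient (part (vertex (not s) y)) j ∎

    ∣cell∣ : ∀ i → ∣ cell i ∣ ≡ size i
    ∣cell∣ i = begin
      ∣ cell i ∣
        ≡⟨ ∣tabulate∣ (λ w → does (part w Fin.≟ i)) ⟩
      sum (λ w → indicator (does (part w Fin.≟ i)))
        ≡⟨ sum-sides s (λ w → indicator (does (part w Fin.≟ i))) ⟩
      _
        ≡⟨ cong₂ _+_ (sum-cong-≗ (same-cell i)) (sum-cong-≗ (opposite-cell i)) ⟩
      sum (sameIndicator i) + sum (oppositeIndicator i)
        ≡⟨ go i ⟩
      size i ∎
      where
      zeros : sum {r} (λ _ → 0) ≡ 0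
      zeros = sum-zero {r} {λ _ → 0} (λ _ → refl)

      go : ∀ i → sum (sameIndicator i) + sum (oppositeIndicator i) ≡ size i
      go 0F = cong₂ _+_ (sum-I x) zeros
      go 1F = cong₂ _+_ zeros (degree x)
      -- The `2n` vertices of `P₂` are counted as the degrees of rows `x` and `σ x`.
      go 2F = trans (cong₂ _+_ (trans (∑-distrib-+ (E x) (E (σ x))) (cong₂ _+_ (degree x) (degree (σ x)))) zeros)
        (ℕ.+-assoc n n 0)
      go 3F = cong₂ _+_ zeros (degree (σ x))
      go 4F = cong₂ _+_ (sum-I (σ x)) zeros
      go 5F = cong₂ _+_ zeros (trans (∑-distrib-+ (I x) (I (σ x))) (cong₂ _+_ (sum-I x) (sum-I (σ x))))

    root-cell : cell 0F ≡ ⁅ vertex s x ⁆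
    root-cell = ⊆-antisym to from
      where
      root : ∀ w → part w ≡ 0F → w ≡ vertex s x
      root w eq with sideView s w
      root w eq | same z with position x z
      ... | base refl = refl
      ... | antipodal refl = contradiction (trans (sym samePart-antipodal) (trans (sym (part-same z)) eq)) λ ()
      ... | generic x≢z σx≢z = contradiction (trans (sym (samePart-generic x≢z σx≢z)) (trans (sym (part-same z)) eq)) λ ()
      root w eq | opposite y = contradiction (trans (sym (part-opposite y)) eq) never
        where
        never : oppositePart y ≢ 0F
        never with does (E x y ℕ.≟ 1) | does (E (σ x) y ℕ.≟ 1)
        ... | true  | _     = λ ()
        ... | false | true  = λ ()
        ... | false | false = λ ()

      to : ∀ {w} → w ∈ cell 0F → w ∈ ⁅ vertex s x ⁆
      to {w} w∈ = subst (_∈ ⁅ vertex s x ⁆) (sym (root w (∈cell⇒ {w = w} w∈))) (x∈⁅x⁆ (vertex s x))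

      from : ∀ {w} → w ∈ ⁅ vertex s x ⁆ → w ∈ cell 0F
      from w∈ = subst (_∈ cell 0F) (sym (x∈⁅y⁆⇒x≡y (vertex s x) w∈)) (∈cell⇐ {w = vertex s x} (trans (part-same x) samePart-base))

  qRegular : QRegular Γ (𝒬 n)
  qRegular u with vertexView u
  ... | at s x = partition , equitable , ∣cell∣ , root-cell
    where open Diagram s x

  conclusion : 2 ∣ n ∸ 1 × Connected Γ × Bipartite Γ × Diameter Γ 4 ×
               AmplyRegular Γ (4 * (n + 1)) n 0 ((n ∸ 1) / 2) × QRegular Γ (𝒬 n)
  -- The divisibility certifies that the integer quotient `(n ∸ 1) / 2`, in the parameters and in
  -- the diagram, is exact.
  conclusion = divides μ n∸1≡μ*2 , connected , bipartite , diameter , amplyRegular , qRegular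

-- From the scheme to its graph

scheme-skewCover : ∀ {n} (S : AssociationScheme 2 n) → 1 < n → NonSymmetric S →
                   ∃ λ μ → SkewCover (C₁ (A₁ S) (A₂ S)) (antipode {n}) n μ
scheme-skewCover S 1<n@(s≤s (s≤s z≤n)) nonSym =
  let A₁ᵀ≐A₂    = transpose-swaps S zero nonSym
      k , l , D = scheme-doublyRegular S A₁ᵀ≐A₂ 1<n
  in k , C₁-skewCover A₁ᵀ≐A₂ D

proposition3p2 : (n : ℕ) → 5 ≤ n → (S : AssociationScheme 2 n) → NonSymmetric S →
    let Γ = schemeGraph S in
    2 ∣ n ∸ 1 ×
    Connected Γ ×
    Bipartite Γ ×
    Diameter Γ 4 ×
    AmplyRegular Γ (4 * (n + 1)) n 0 ((n ∸ 1) / 2) ×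
    QRegular Γ (𝒬 n)
proposition3p2 n 5≤n S nonSym =
  SkewCoverGraph.conclusion {C = C₁ (A₁ S) (A₂ S)} {σ = antipode {n}}
    (proj₂ (scheme-skewCover S (ℕ.≤-trans (s≤s (s≤s z≤n)) 5≤n) nonSym))
    -- The same adjacency proof as in `schemeGraph`, so that the two graphs agree definitionally.
    (B-isAdjacencyMatrix (C₁-01 (zero-one 1F) (zero-one 2F)))
  where open AssociationScheme S
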